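{- Let $k \ge 2$ be an integer and $n \ge k+1$. If $\mathcal{F} \subseteq 2^{[n]}$ contains neither $Y_k$ nor $Y'_k$ as an induced subposet and $\varnothing \notin \mathcal{F}$, $[n] \notin \mathcal{F}$, then $$\sum_{F\in \mathcal{F}} \binom{n}{|F|}^{ -1} \le k.$$ In particular, $|\mathcal{F}|\le \Sigma(n,k)$.
   Context: $[n]=\{1,\dots,n\}$ and $2^{[n]}$ is ordered by inclusion. For an integer $k\ge 2$, the poset $Y_k$ consists of $k+2$ distinct elements $x_1,\dots,x_k,y_1,y_2$ with $x_1 < x_2 < \dots < x_k$ and $x_k < y_1$, $x_k < y_2$ (and the relations implied by transitivity; $y_1,y_2$ incomparable). $Y'_k$ is the dual (reversed) poset of $Y_k$. A poset $P$ is contained in a family $\mathcal{F}$ as an induced subposet if there is an injection $\alpha: P \to \mathcal{F}$ with $x_1 <_P x_2 \iff \alpha(x_1) \subsetneq \alpha(x_2)$ for all $x_1,x_2 \in P$. $\Sigma(n,k)$ denotes the sum of the $k$ largest binomial coefficients $\binom{n}{i}$, $0\le i\le n$. -}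

module Defs where

open import Data.Nat using (ℕ; zero; suc)
open import Data.Nat.Properties using (≤-decTotalOrder)
open import Data.Nat.Combinatorics using (_C_)
open import Data.Fin using (Fin) renaming (_<_ to _<ᶠ_)
open import Data.Fin.Subset using (Subset; _⊂_; ∣_∣)
open import Data.List using (List; map; foldr; take; reverse; upTo)
open import Data.Nat.ListAction using (sum)
open import Data.List.Sort ≤-decTotalOrder using (sort)
open import Data.List.Membership.Propositional using (_∈_)
open import Data.Integer using (+_)
open import Data.Rational using (ℚ; 0ℚ; _/_; _+_)
open import Data.Product using (_×_; Σ)
open import Function.Definitions using (Injective)
open import Relation.Binary.PropositionalEquality using (_≡_)
open import Function.Bundles using (_⇔_)

-- A family of subsets of [n]: a duplicate-free list (Unique is imposed in the statement).
Family : ℕ → Set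
Family n = List (Subset n)

data Yel (k : ℕ) : Set where
  xe : Fin k → Yel k
  y₁ : Yel k
  y₂ : Yel k

-- Strict order of Y_k (already transitively closed).
data _<Y_ {k : ℕ} : Yel k → Yel k → Set where
  x<x  : {i j : Fin k} → i <ᶠ j → xe i <Y xe j
  x<y₁ : {i : Fin k} → xe i <Y y₁
  x<y₂ : {i : Fin k} → xe i <Y y₂

_<Y'_ : {k : ℕ} → Yel k → Yel k → Set
a <Y' b = b <Y a

InducedIn : {n : ℕ} (P : Set) → (P → P → Set) → Family n → Set
InducedIn {n} P _<P_ F =
  Σ (P → Subset n) λ α →
    Injective _≡_ _≡_ α ×
    ((p : P) → α p ∈ F) ×
    ((p q : P) → (p <P q) ⇔ (α p ⊂ α q))

-- 1/m as a rational (only applied to m = C(n,|F|) ≥ 1; the zero case is a dummy).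
recip : ℕ → ℚ
recip zero    = 0ℚ
recip (suc m) = (+ 1) / suc m

lubell : {n : ℕ} → Family n → ℚ
lubell {n} F = foldr (λ A s → recip (n C ∣ A ∣) + s) 0ℚ F

Σnk : ℕ → ℕ → ℕ
Σnk n k = sum (take k (reverse (sort (map (n C_) (upTo (suc n))))))

{-# OPTIONS --safe #-}

-- Call A ∈ F upper linear (lower linear) if the members of F strictly above (below) A form a
-- chain.  In a Y_k-free family every chain of members that are not upper linear has fewer than
-- k elements.  Since every member is counted twice by
--   ([not upper linear] + [lower linear]) + ([not lower linear] + [upper linear]),
-- it suffices that the first bracket, summed over the members of F on a random full chain, has
-- expectation at most k; the second bracket is the first one for the family of complements.
--
-- The averages are estimated by flipping a full chain below one of its members Z: the first and
-- the last element added before reaching Z are exchanged.  If the chain passes through A ⊊ Z,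
-- then the flipped chain misses every nonempty B ⊊ Z comparable to A.  Chains containing a
-- core (a member that is both upper and lower linear) are flipped below each of their cores,
-- the other ones below their largest lower linear member.
module Submission where

import Data.Nat.Properties
open import Defs
open import Algebra.Properties.CommutativeMonoid.Sum Data.Nat.Properties.+-0-commutativeMonoid using (sum-permute; sum-cong-≗; ∑-distrib-+) renaming (sum to sumᶠ)
open import Data.Bool.Properties using (not-involutive) renaming (_≟_ to _≟ᵇ_)
open import Data.Empty using (⊥-elim)
open import Data.Fin as Fin using (Fin; zero; suc; toℕ; fromℕ; fromℕ<; inject≤; punchIn; punchOut)
open import Data.Fin.Permutation as Perm using (Permutation′; _⟨$⟩ʳ_; transpose; punchIn-permute)
import Data.Fin.Permutation.Components as PC
open import Data.Fin.Properties as Fin using (punchIn-punchOut; toℕ-fromℕ<; toℕ-inject≤; toℕ-fromℕ; toℕ≤pred[n])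
open import Data.Fin.Subset using (Subset; inside; outside; _⊆_; _⊂_; ∣_∣; ⊥; ⊤; ∁) renaming (_∈_ to _∈ˢ_; _∉_ to _∉ˢ_)
open import Data.Fin.Subset.Properties
open import Data.Integer as ℤ using () renaming (+_ to pos)
import Data.Integer.Properties as ℤ
open import Data.List as List using (List; []; _∷_; _++_; length; map; reverse; upTo; filter; take; drop)
open import Data.List.Membership.Propositional using (_∈_; _∉_; find; lose)
open import Data.List.Membership.Propositional.Properties using (∈-map⁺; ∈-map⁻; ∈-filter⁻; ∈-lookup; ∈-upTo⁺; ∈-upTo⁻)
open import Data.List.Properties using (unfold-reverse; take-map; take++drop≡id; length-take; length-upTo)
open import Data.List.Relation.Binary.Permutation.Propositional using (_↭_; ↭-sym; ↭-trans)
open import Data.List.Relation.Binary.Permutation.Propositional.Properties using (↭-map-inv; ↭-reverse; ↭-length; All-resp-↭) renaming (map⁺ to ↭-map⁺)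
open import Data.List.Relation.Unary.All as All using (All; []; _∷_; all?)
import Data.List.Relation.Unary.All.Properties as All
open import Data.List.Relation.Unary.AllPairs using (AllPairs; []; _∷_)
import Data.List.Relation.Unary.AllPairs.Properties as AllPairs
open import Data.List.Relation.Unary.Any using (here; there; any?)
open import Data.List.Relation.Unary.Linked.Properties using (Linked⇒AllPairs)
open import Data.List.Relation.Unary.Unique.Propositional using (Unique)
import Data.List.Relation.Unary.Unique.Propositional.Properties as Unique
open import Data.List.Sort Data.Nat.Properties.≤-decTotalOrder using (sort-↭; sort-↗)
open import Data.Nat hiding (_/_)
open import Data.Nat.Combinatorics using (_C_; nCk≡n!/k![n-k]!; k![n∸k]!∣n!)
open import Data.Nat.DivMod using (m/n*n≡m)
open import Data.Nat.ListAction using () renaming (sum to sumˡ)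
open import Data.Nat.ListAction.Properties using (sum-↭)
open import Data.Nat.Properties
open import Data.Nat.Solver using (module +-*-Solver)
open import Data.Product as Product using (_×_; _,_; ∃; proj₁; proj₂)
open import Data.Rational as ℚ using (toℚᵘ; _/_) renaming (_≤_ to _≤ℚ_)
import Data.Rational.Properties as ℚ
open import Data.Rational.Unnormalised as ℚᵘ using (mkℚᵘ; *≡*; *≤*)
import Data.Rational.Unnormalised.Properties as ℚᵘ
open import Data.Sum using (_⊎_; inj₁; inj₂; swap)
open import Data.Vec as Vec using (Vec; []; _∷_; here; there; lookup)
open import Data.Vec.Properties using (lookup-map; map-∘; map-cong; map-id; map-replicate; ≡-dec)
open import Function using (_∘_; id; it; case_of_; mk⇔; Equivalence)
open import Relation.Binary.Definitions using (tri<; tri≈; tri>)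
open import Relation.Binary.PropositionalEquality using (_≡_; _≢_; refl; sym; trans; cong; cong₂; subst; subst₂; module ≡-Reasoning)
open import Relation.Nullary using (¬_; Dec; yes; no; contradiction)
open import Relation.Nullary.Decidable using (_×-dec_; _→-dec_; _⊎-dec_; ¬?; decidable-stable)

private variable
  m n : ℕ
  X Y : Set
  P Q R : Set

-- Indicators of decidable propositions

𝟙 : Dec P → ℕ
𝟙 (yes _) = 1
𝟙 (no _)  = 0

𝟙-true : (P? : Dec P) → P → 𝟙 P? ≡ 1
𝟙-true (yes _) _ = refl
𝟙-true (no ¬p) p = contradiction p ¬p

𝟙-false : (P? : Dec P) → ¬ P → 𝟙 P? ≡ 0
𝟙-false (yes p) ¬p = contradiction p ¬p
𝟙-false (no _)  _  = refl

𝟙-mono : (P? : Dec P) (Q? : Dec Q) → (P → Q) → 𝟙 P? ≤ 𝟙 Q?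
𝟙-mono (no _)  Q? f = z≤n
𝟙-mono (yes p) Q? f = ≤-reflexive (sym (𝟙-true Q? (f p)))

𝟙-cong : (P? : Dec P) (Q? : Dec Q) → (P → Q) → (Q → P) → 𝟙 P? ≡ 𝟙 Q?
𝟙-cong P? Q? f g = ≤-antisym (𝟙-mono P? Q? f) (𝟙-mono Q? P? g)

𝟙-⊎ : (P? : Dec P) (Q? : Dec Q) (R? : Dec R) → (P → Q ⊎ R) → 𝟙 P? ≤ 𝟙 Q? + 𝟙 R?
𝟙-⊎ (no _)  Q? R? f = z≤n
𝟙-⊎ (yes p) Q? R? f with f p
... | inj₁ q = ≤-trans (≤-reflexive (sym (𝟙-true Q? q))) (m≤m+n _ _)
... | inj₂ r = ≤-trans (≤-reflexive (sym (𝟙-true R? r))) (m≤n+m _ _)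

𝟙-disjoint : (P? : Dec P) (Q? : Dec Q) (R? : Dec R) →
             (P → R) → (Q → R) → (P → ¬ Q) → 𝟙 P? + 𝟙 Q? ≤ 𝟙 R?
𝟙-disjoint (yes p) Q? R? f g h rewrite 𝟙-false Q? (h p) = ≤-reflexive (sym (𝟙-true R? (f p)))
𝟙-disjoint (no _)  Q? R? f g h = 𝟙-mono Q? R? g

-- Summation over full chains

-- A full chain is given by the vector of positions of the elements of [n].
Chain : ℕ → Set
Chain n = Vec (Fin n) n

-- Element `zero` takes position `i`, and the positions of the other elements are shifted so as to
-- skip `i`. Every permutation arises from exactly one such pair.
insert : Fin (suc n) → Chain n → Chain (suc n)
insert i v = i ∷ Vec.map (punchIn i) v

-- Iterating `insert` reaches each of the n! bijective vectors exactly once, so this is the sum over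
-- all full chains, although the type `Chain` also contains vectors with repetitions.
∑ᶜ : (Chain n → ℕ) → ℕ
∑ᶜ {zero}  f = f []
∑ᶜ {suc n} f = sumᶠ λ i → ∑ᶜ λ v → f (insert i v)

-- Holds for every vector that `∑ᶜ` visits; `∑ᶜ-mono` passes it on to the pointwise inequality,
-- where flipping has to find the element at a given position.
Onto : Chain n → Set
Onto v = ∀ i → ∃ λ x → lookup v x ≡ i

insert-onto : (i : Fin (suc n)) {v : Chain n} → Onto v → Onto (insert i v)
insert-onto i {v} v-onto j with i Fin.≟ j
... | yes i≡j = zero , i≡j
... | no i≢j  = let x , vx≡ = v-onto (punchOut i≢j) in
  suc x , trans (lookup-map x (punchIn i) v) (trans (cong (punchIn i) vx≡) (punchIn-punchOut i≢j))

sumᶠ-mono : {f g : Fin m → ℕ} → (∀ i → f i ≤ g i) → sumᶠ f ≤ sumᶠ g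
sumᶠ-mono {zero}  f≤g = z≤n
sumᶠ-mono {suc m} f≤g = +-mono-≤ (f≤g zero) (sumᶠ-mono (f≤g ∘ suc))

sumᶠ-const : ∀ m c → sumᶠ {m} (λ _ → c) ≡ m * c
sumᶠ-const zero    c = refl
sumᶠ-const (suc m) c = cong (c +_) (sumᶠ-const m c)

sumᶠ-*ʳ : (f : Fin m → ℕ) (c : ℕ) → sumᶠ (λ i → f i * c) ≡ sumᶠ f * c
sumᶠ-*ʳ {zero}  f c = refl
sumᶠ-*ʳ {suc m} f c = trans (cong (f zero * c +_) (sumᶠ-*ʳ (f ∘ suc) c))
                            (sym (*-distribʳ-+ c (f zero) (sumᶠ (f ∘ suc))))

∑ᶜ-mono : {f g : Chain n → ℕ} → (∀ v → Onto v → f v ≤ g v) → ∑ᶜ f ≤ ∑ᶜ g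
∑ᶜ-mono {zero}  f≤g = f≤g [] λ ()
∑ᶜ-mono {suc n} f≤g = sumᶠ-mono λ i → ∑ᶜ-mono λ v v-onto → f≤g (insert i v) (insert-onto i {v} v-onto)

∑ᶜ-cong : {f g : Chain n → ℕ} → (∀ v → f v ≡ g v) → ∑ᶜ f ≡ ∑ᶜ g
∑ᶜ-cong {zero}  f≡g = f≡g []
∑ᶜ-cong {suc n} f≡g = sum-cong-≗ {suc n} λ i → ∑ᶜ-cong λ v → f≡g (insert i v)

∑ᶜ-distrib-+ : (f g : Chain n → ℕ) → ∑ᶜ (λ v → f v + g v) ≡ ∑ᶜ f + ∑ᶜ g
∑ᶜ-distrib-+ {zero}  f g = refl
∑ᶜ-distrib-+ {suc n} f g =
  trans (sum-cong-≗ λ i → ∑ᶜ-distrib-+ (f ∘ insert i) (g ∘ insert i))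
        (∑-distrib-+ (λ i → ∑ᶜ (f ∘ insert i)) (λ i → ∑ᶜ (g ∘ insert i)))

∑ᶜ-*ʳ : (f : Chain n → ℕ) (c : ℕ) → ∑ᶜ (λ v → f v * c) ≡ ∑ᶜ f * c
∑ᶜ-*ʳ {zero}  f c = refl
∑ᶜ-*ʳ {suc n} f c = trans (sum-cong-≗ λ i → ∑ᶜ-*ʳ (f ∘ insert i) c)
                          (sumᶠ-*ʳ (λ i → ∑ᶜ (f ∘ insert i)) c)

∑ᶜ-const : ∀ n c → ∑ᶜ {n} (λ _ → c) ≡ n ! * c
∑ᶜ-const zero    c = sym (+-identityʳ c)
∑ᶜ-const (suc n) c = begin
  sumᶠ {suc n} (λ _ → ∑ᶜ {n} λ _ → c)  ≡⟨ sumᶠ-const (suc n) _ ⟩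
  suc n * ∑ᶜ {n} (λ _ → c)             ≡⟨ cong (suc n *_) (∑ᶜ-const n c) ⟩
  suc n * (n ! * c)                    ≡⟨ *-assoc (suc n) (n !) c ⟨
  suc n ! * c                          ∎
  where open ≡-Reasoning

relabel : Permutation′ n → Chain n → Chain n
relabel σ = Vec.map (σ ⟨$⟩ʳ_)

relabel-insert : (σ : Permutation′ (suc n)) (i : Fin (suc n)) (v : Chain n) →
                 relabel σ (insert i v) ≡ insert (σ ⟨$⟩ʳ i) (relabel (Perm.remove i σ) v)
relabel-insert σ i v = cong ((σ ⟨$⟩ʳ i) ∷_)
  (trans (sym (map-∘ (σ ⟨$⟩ʳ_) (punchIn i) v))
  (trans (map-cong (punchIn-permute σ i) v)
         (map-∘ (punchIn (σ ⟨$⟩ʳ i)) (Perm.remove i σ ⟨$⟩ʳ_) v)))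

-- Induction on n: `σ` permutes the outer index, and on the remaining positions it acts as
-- `Perm.remove i σ`, under which the inner sum is invariant.
∑ᶜ-relabel : (σ : Permutation′ n) (f : Chain n → ℕ) → ∑ᶜ (f ∘ relabel σ) ≡ ∑ᶜ f
∑ᶜ-relabel {zero}  σ f = refl
∑ᶜ-relabel {suc n} σ f = begin
  sumᶠ {suc n} (λ i → ∑ᶜ λ v → f (relabel σ (insert i v)))
    ≡⟨ sum-cong-≗ {suc n} (λ i → ∑ᶜ-cong λ v → cong f (relabel-insert σ i v)) ⟩
  sumᶠ {suc n} (λ i → ∑ᶜ λ v → f (insert (σ ⟨$⟩ʳ i) (relabel (Perm.remove i σ) v)))
    ≡⟨ sum-cong-≗ {suc n} (λ i → ∑ᶜ-relabel (Perm.remove i σ) (f ∘ insert (σ ⟨$⟩ʳ i))) ⟩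
  sumᶠ {suc n} (λ i → ∑ᶜ λ v → f (insert (σ ⟨$⟩ʳ i) v))
    ≡⟨ sum-permute (λ i → ∑ᶜ (f ∘ insert i)) σ ⟨
  sumᶠ {suc n} (λ i → ∑ᶜ λ v → f (insert i v))  ∎
  where open ≡-Reasoning

-- Sets on a full chain

-- A is the set of the first ∣ A ∣ elements of the chain.
Hit : Chain n → Subset n → Set
Hit v A = ∀ x → (x ∈ˢ A → toℕ (lookup v x) < ∣ A ∣) × (toℕ (lookup v x) < ∣ A ∣ → x ∈ˢ A)

hit? : (v : Chain n) (A : Subset n) → Dec (Hit v A)
hit? v A = Fin.all? λ x → ((x ∈? A) →-dec (toℕ (lookup v x) <? ∣ A ∣)) ×-dec
                          ((toℕ (lookup v x) <? ∣ A ∣) →-dec (x ∈? A))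

Comparable : Subset n → Subset n → Set
Comparable A B = A ⊆ B ⊎ B ⊆ A

hit-mono : (v : Chain n) {A B : Subset n} → Hit v A → Hit v B → ∣ A ∣ ≤ ∣ B ∣ → A ⊆ B
hit-mono v hA hB A≤B {x} x∈A = proj₂ (hB x) (≤-trans (proj₁ (hA x) x∈A) A≤B)

hit-comparable : (v : Chain n) {A B : Subset n} → Hit v A → Hit v B → Comparable A B
hit-comparable v {A} {B} hA hB with ≤-total ∣ A ∣ ∣ B ∣
... | inj₁ A≤B = inj₁ (hit-mono v hA hB A≤B)
... | inj₂ B≤A = inj₂ (hit-mono v hB hA B≤A)

-- When position `i` is taken out, a threshold above `i` drops by one (here) and a threshold up to
-- `i` stays (`punchIn-<`). This reduces `Hit` on a longer chain to `Hit` on the shorter one.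
punchIn-<-suc : (i : Fin (suc n)) (j : Fin n) (s : ℕ) → toℕ i ≤ s →
  (toℕ (punchIn i j) < suc s → toℕ j < s) × (toℕ j < s → toℕ (punchIn i j) < suc s)
punchIn-<-suc zero    j       s       _         = s<s⁻¹ , s<s
punchIn-<-suc (suc i) zero    (suc s) _         = (λ _ → z<s) , (λ _ → z<s)
punchIn-<-suc (suc i) (suc j) (suc s) (s≤s i≤s) =
  let f , g = punchIn-<-suc i j s i≤s in s<s ∘ f ∘ s<s⁻¹ , s<s ∘ g ∘ s<s⁻¹

punchIn-< : (i : Fin (suc n)) (j : Fin n) (s : ℕ) → s ≤ toℕ i →
  (toℕ (punchIn i j) < s → toℕ j < s) × (toℕ j < s → toℕ (punchIn i j) < s)
punchIn-< i       j       zero    _         = (λ ()) , (λ ())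
punchIn-< (suc i) zero    (suc s) _         = (λ _ → z<s) , (λ _ → z<s)
punchIn-< (suc i) (suc j) (suc s) (s≤s s≤i) =
  let f , g = punchIn-< i j s s≤i in s<s ∘ f ∘ s<s⁻¹ , s<s ∘ g ∘ s<s⁻¹

toℕ-lookup-insert : (i : Fin (suc n)) (v : Chain n) (x : Fin n) →
  toℕ (lookup (Vec.map (punchIn i) v) x) ≡ toℕ (punchIn i (lookup v x))
toℕ-lookup-insert i v x = cong toℕ (lookup-map x (punchIn i) v)

-- The condition separates into one on `i` and one on `v`, so the number of chains through a set is
-- a product at each step of the induction.
hit-insert-inside : (i : Fin (suc n)) (v : Chain n) (A : Subset n) →
  (Hit (insert i v) (inside ∷ A) → toℕ i ≤ ∣ A ∣ × Hit v A) ×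
  (toℕ i ≤ ∣ A ∣ × Hit v A → Hit (insert i v) (inside ∷ A))
hit-insert-inside i v A = to , from
  where
  to : Hit (insert i v) (inside ∷ A) → toℕ i ≤ ∣ A ∣ × Hit v A
  to h = i≤A , λ x →
      (λ x∈A → proj₁ (punchIn-<-suc i (lookup v x) ∣ A ∣ i≤A)
        (subst (_< suc ∣ A ∣) (toℕ-lookup-insert i v x) (proj₁ (h (suc x)) (there x∈A))))
    , (λ vx<A → drop-there (proj₂ (h (suc x))
        (subst (_< suc ∣ A ∣) (sym (toℕ-lookup-insert i v x))
          (proj₂ (punchIn-<-suc i (lookup v x) ∣ A ∣ i≤A) vx<A))))
    where i≤A = s≤s⁻¹ (proj₁ (h zero) here)
  from : toℕ i ≤ ∣ A ∣ × Hit v A → Hit (insert i v) (inside ∷ A)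
  from (i≤A , h) zero    = (λ _ → s≤s i≤A) , (λ _ → here)
  from (i≤A , h) (suc x) =
      (λ x∈A → subst (_< suc ∣ A ∣) (sym (toℕ-lookup-insert i v x))
        (proj₂ (punchIn-<-suc i (lookup v x) ∣ A ∣ i≤A) (proj₁ (h x) (drop-there x∈A))))
    , (λ vx<A → there (proj₂ (h x) (proj₁ (punchIn-<-suc i (lookup v x) ∣ A ∣ i≤A)
        (subst (_< suc ∣ A ∣) (toℕ-lookup-insert i v x) vx<A))))

hit-insert-outside : (i : Fin (suc n)) (v : Chain n) (A : Subset n) →
  (Hit (insert i v) (outside ∷ A) → ∣ A ∣ ≤ toℕ i × Hit v A) ×
  (∣ A ∣ ≤ toℕ i × Hit v A → Hit (insert i v) (outside ∷ A))
hit-insert-outside i v A = to , from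
  where
  to : Hit (insert i v) (outside ∷ A) → ∣ A ∣ ≤ toℕ i × Hit v A
  to h = A≤i , λ x →
      (λ x∈A → proj₁ (punchIn-< i (lookup v x) ∣ A ∣ A≤i)
        (subst (_< ∣ A ∣) (toℕ-lookup-insert i v x) (proj₁ (h (suc x)) (there x∈A))))
    , (λ vx<A → drop-there (proj₂ (h (suc x))
        (subst (_< ∣ A ∣) (sym (toℕ-lookup-insert i v x))
          (proj₂ (punchIn-< i (lookup v x) ∣ A ∣ A≤i) vx<A))))
    where A≤i = ≮⇒≥ λ i<A → case proj₂ (h zero) i<A of λ ()
  from : ∣ A ∣ ≤ toℕ i × Hit v A → Hit (insert i v) (outside ∷ A)
  from (A≤i , h) zero    = (λ ()) , (λ i<A → contradiction i<A (≤⇒≯ A≤i))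
  from (A≤i , h) (suc x) =
      (λ x∈A → subst (_< ∣ A ∣) (sym (toℕ-lookup-insert i v x))
        (proj₂ (punchIn-< i (lookup v x) ∣ A ∣ A≤i) (proj₁ (h x) (drop-there x∈A))))
    , (λ vx<A → there (proj₂ (h x) (proj₁ (punchIn-< i (lookup v x) ∣ A ∣ A≤i)
        (subst (_< ∣ A ∣) (toℕ-lookup-insert i v x) vx<A))))

-- The factors are swapped so that the one free of the summation variable stands on the right, as in
-- `∑ᶜ-*ʳ`.
𝟙-× : (P? : Dec P) (Q? : Dec Q) (R? : Dec R) → (R → P × Q) → (P × Q → R) → 𝟙 R? ≡ 𝟙 Q? * 𝟙 P?
𝟙-× (yes p) (yes q) R? f g = 𝟙-true R? (g (p , q))
𝟙-× (no ¬p) Q?      R? f g = trans (𝟙-false R? (¬p ∘ proj₁ ∘ f)) (sym (*-zeroʳ (𝟙 Q?)))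
𝟙-× (yes p) (no ¬q) R? f g = 𝟙-false R? (¬q ∘ proj₂ ∘ f)

sumᶠ-≤ : ∀ m s → s < m → sumᶠ {m} (λ i → 𝟙 (toℕ i ≤? s)) ≡ suc s
sumᶠ-≤ (suc m) zero    s<m = cong suc (trans
  (sum-cong-≗ {m} λ i → 𝟙-false (suc (toℕ i) ≤? 0) λ ()) (trans (sumᶠ-const m 0) (*-zeroʳ m)))
sumᶠ-≤ (suc m) (suc s) (s≤s s<m) = cong suc (trans
  (sum-cong-≗ {m} λ i → 𝟙-cong (suc (toℕ i) ≤? suc s) (toℕ i ≤? s) s≤s⁻¹ s≤s) (sumᶠ-≤ m s s<m))

sumᶠ-≥ : ∀ m s → s ≤ m → sumᶠ {m} (λ i → 𝟙 (s ≤? toℕ i)) ≡ m ∸ s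
sumᶠ-≥ m zero s≤m = trans (sum-cong-≗ {m} λ i → 𝟙-true (0 ≤? toℕ i) z≤n) (trans (sumᶠ-const m 1) (*-identityʳ m))
sumᶠ-≥ (suc m) (suc s) (s≤s s≤m) = trans
  (sum-cong-≗ {m} λ i → 𝟙-cong (suc s ≤? suc (toℕ i)) (s ≤? toℕ i) s≤s⁻¹ s≤s) (sumᶠ-≥ m s s≤m)

-- The number of full chains through `A`, which is n! divided by the binomial coefficient of `A`.
-- The estimates use these integers; the Lubell function is their sum over the family divided by n!.
hits : Subset n → ℕ
hits {n} A = ∣ A ∣ ! * (n ∸ ∣ A ∣) !

-- Peel off the first element. If it belongs to the set, it must take one of the first ∣ A ∣ + 1
-- positions; otherwise one of the last n + 1 - ∣ A ∣. This count is the new factor in one of the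
-- two factorials.
∑ᶜ-hit : (A : Subset n) → ∑ᶜ (λ v → 𝟙 (hit? v A)) ≡ hits A
∑ᶜ-hit []  = 𝟙-true (hit? [] []) λ ()
∑ᶜ-hit {suc n} (inside ∷ A) = begin
  sumᶠ {suc n} (λ i → ∑ᶜ λ v → 𝟙 (hit? (insert i v) (inside ∷ A)))
    ≡⟨ sum-cong-≗ {suc n} (λ i → ∑ᶜ-cong {n} λ v → let f , g = hit-insert-inside i v A in
         𝟙-× (toℕ i ≤? ∣ A ∣) (hit? v A) (hit? (insert i v) (inside ∷ A)) f g) ⟩
  sumᶠ {suc n} (λ i → ∑ᶜ λ v → 𝟙 (hit? v A) * 𝟙 (toℕ i ≤? ∣ A ∣))
    ≡⟨ sum-cong-≗ {suc n} (λ i → trans (∑ᶜ-*ʳ {n} (λ v → 𝟙 (hit? v A)) (𝟙 (toℕ i ≤? ∣ A ∣)))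
         (trans (cong (_* 𝟙 (toℕ i ≤? ∣ A ∣)) (∑ᶜ-hit A)) (*-comm (hits A) (𝟙 (toℕ i ≤? ∣ A ∣))))) ⟩
  sumᶠ {suc n} (λ i → 𝟙 (toℕ i ≤? ∣ A ∣) * hits A)
    ≡⟨ sumᶠ-*ʳ {suc n} (λ i → 𝟙 (toℕ i ≤? ∣ A ∣)) (hits A) ⟩
  sumᶠ {suc n} (λ i → 𝟙 (toℕ i ≤? ∣ A ∣)) * hits A
    ≡⟨ cong (_* hits A) (sumᶠ-≤ (suc n) ∣ A ∣ (s≤s (∣p∣≤n A))) ⟩
  suc ∣ A ∣ * (∣ A ∣ ! * (n ∸ ∣ A ∣) !)
    ≡⟨ *-assoc (suc ∣ A ∣) (∣ A ∣ !) ((n ∸ ∣ A ∣) !) ⟨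
  suc ∣ A ∣ ! * (n ∸ ∣ A ∣) !  ∎
  where open ≡-Reasoning
∑ᶜ-hit {suc n} (outside ∷ A) = begin
  sumᶠ {suc n} (λ i → ∑ᶜ λ v → 𝟙 (hit? (insert i v) (outside ∷ A)))
    ≡⟨ sum-cong-≗ {suc n} (λ i → ∑ᶜ-cong {n} λ v → let f , g = hit-insert-outside i v A in
         𝟙-× (∣ A ∣ ≤? toℕ i) (hit? v A) (hit? (insert i v) (outside ∷ A)) f g) ⟩
  sumᶠ {suc n} (λ i → ∑ᶜ λ v → 𝟙 (hit? v A) * 𝟙 (∣ A ∣ ≤? toℕ i))
    ≡⟨ sum-cong-≗ {suc n} (λ i → trans (∑ᶜ-*ʳ {n} (λ v → 𝟙 (hit? v A)) (𝟙 (∣ A ∣ ≤? toℕ i)))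
         (trans (cong (_* 𝟙 (∣ A ∣ ≤? toℕ i)) (∑ᶜ-hit A)) (*-comm (hits A) (𝟙 (∣ A ∣ ≤? toℕ i))))) ⟩
  sumᶠ {suc n} (λ i → 𝟙 (∣ A ∣ ≤? toℕ i) * hits A)
    ≡⟨ sumᶠ-*ʳ {suc n} (λ i → 𝟙 (∣ A ∣ ≤? toℕ i)) (hits A) ⟩
  sumᶠ {suc n} (λ i → 𝟙 (∣ A ∣ ≤? toℕ i)) * hits A
    ≡⟨ cong (_* hits A) (trans (sumᶠ-≥ (suc n) ∣ A ∣ (m≤n⇒m≤1+n (∣p∣≤n A))) 1+n∸A) ⟩
  suc (n ∸ ∣ A ∣) * (∣ A ∣ ! * (n ∸ ∣ A ∣) !)
    ≡⟨ solve 3 (λ a b c → a :* (b :* c) := b :* (a :* c)) refl (suc (n ∸ ∣ A ∣)) (∣ A ∣ !) ((n ∸ ∣ A ∣) !) ⟩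
  ∣ A ∣ ! * suc (n ∸ ∣ A ∣) !
    ≡⟨ cong (λ d → ∣ A ∣ ! * d !) 1+n∸A ⟨
  ∣ A ∣ ! * (suc n ∸ ∣ A ∣) !  ∎
  where
  open ≡-Reasoning
  open +-*-Solver
  1+n∸A : suc n ∸ ∣ A ∣ ≡ suc (n ∸ ∣ A ∣)
  1+n∸A = +-∸-assoc 1 (∣p∣≤n A)

-- Flipping a chain below one of its members

transpose-i : (i j : Fin n) → PC.transpose i j i ≡ j
transpose-i i j with i Fin.≟ i
... | yes _  = refl
... | no i≢i = contradiction refl i≢i

transpose-j : (i j : Fin n) → PC.transpose i j j ≡ i
transpose-j i j with j Fin.≟ i
... | yes j≡i = j≡i
... | no _ with j Fin.≟ j
...   | yes _  = refl
...   | no j≢j = contradiction refl j≢j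

transpose-< : (i j k : Fin n) {t : ℕ} → toℕ i < t → toℕ j < t →
  (toℕ (PC.transpose i j k) < t → toℕ k < t) × (toℕ k < t → toℕ (PC.transpose i j k) < t)
transpose-< i j k i<t j<t with k Fin.≟ i
... | yes refl = (λ _ → i<t) , (λ _ → j<t)
... | no _ with k Fin.≟ j
...   | yes refl = (λ _ → j<t) , (λ _ → i<t)
...   | no _     = id , id

-- The indices 0 and ∣ Z ∣ - 1: `fromℕ<` reads its value off the type of the inequality.
firstPos lastPos : (Z : Subset n) → 0 < ∣ Z ∣ → Fin n
firstPos Z 0<Z = fromℕ< (≤-trans 0<Z (∣p∣≤n Z))
lastPos  Z 0<Z = fromℕ< (≤-trans (≤-reflexive (suc-pred ∣ Z ∣ ⦃ >-nonZero 0<Z ⦄)) (∣p∣≤n Z))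

-- On a chain through Z, exchanges the first and the last of the elements that make up Z.
flip : (Z : Subset n) → 0 < ∣ Z ∣ → Chain n → Chain n
flip Z 0<Z = relabel (transpose (firstPos Z 0<Z) (lastPos Z 0<Z))

module _ (Z : Subset n) (0<Z : 0 < ∣ Z ∣) where
  private
    p q : Fin n
    p = firstPos Z 0<Z
    q = lastPos Z 0<Z

    p≡0 : toℕ p ≡ 0
    p≡0 = toℕ-fromℕ< _

    q+1≡ : suc (toℕ q) ≡ ∣ Z ∣
    q+1≡ = trans (cong suc (toℕ-fromℕ< _)) (suc-pred ∣ Z ∣ ⦃ >-nonZero 0<Z ⦄)

    p<Z : toℕ p < ∣ Z ∣
    p<Z = subst (_< ∣ Z ∣) (sym p≡0) 0<Z

    lookup-flip : ∀ v x → lookup (flip Z 0<Z v) x ≡ PC.transpose p q (lookup v x)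
    lookup-flip v x = lookup-map x _ v

  ∑ᶜ-flip : (f : Chain n → ℕ) → ∑ᶜ (f ∘ flip Z 0<Z) ≡ ∑ᶜ f
  ∑ᶜ-flip = ∑ᶜ-relabel (transpose p q)

  -- Both exchanged positions lie below ∣ Z ∣, hence below ∣ A ∣, so the set of the first ∣ A ∣
  -- elements is unchanged.
  flip-hit : (v : Chain n) {A : Subset n} → ∣ Z ∣ ≤ ∣ A ∣ → Hit v A → Hit (flip Z 0<Z v) A
  flip-hit v {A} Z≤A h x with tr ← transpose-< p q (lookup v x) (≤-trans p<Z Z≤A) (≤-trans (≤-reflexive q+1≡) Z≤A)
    rewrite lookup-flip v x = proj₂ tr ∘ proj₁ (h x) , proj₂ (h x) ∘ proj₁ tr

  flip-hit⁻ : (v : Chain n) {A : Subset n} → ∣ Z ∣ ≤ ∣ A ∣ → Hit (flip Z 0<Z v) A → Hit v A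
  flip-hit⁻ v {A} Z≤A h x with tr ← transpose-< p q (lookup v x) (≤-trans p<Z Z≤A) (≤-trans (≤-reflexive q+1≡) Z≤A)
    = proj₁ tr ∘ subst (λ j → toℕ j < ∣ A ∣) (lookup-flip v x) ∘ proj₁ (h x)
    , proj₂ (h x) ∘ subst (λ j → toℕ j < ∣ A ∣) (sym (lookup-flip v x)) ∘ proj₂ tr

  -- The first element added lies in A and not in B, the last one in B and not in A.
  flip-disjoint : (v : Chain n) → Onto v → {A B : Subset n} → 0 < ∣ A ∣ → 0 < ∣ B ∣ →
    ∣ A ∣ < ∣ Z ∣ → ∣ B ∣ < ∣ Z ∣ → Hit v A → Hit (flip Z 0<Z v) B → ¬ Comparable A B
  flip-disjoint v v-onto {A} {B} 0<A 0<B A<Z B<Z hA hB = λ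
    { (inj₁ A⊆B) → x∉B (A⊆B x∈A) ; (inj₂ B⊆A) → y∉A (B⊆A y∈B) }
    where
    x = proj₁ (v-onto p)
    vx≡p = proj₂ (v-onto p)
    y = proj₁ (v-onto q)
    vy≡q = proj₂ (v-onto q)
    x∈A : x ∈ˢ A
    x∈A = proj₂ (hA x) (subst (_< ∣ A ∣) (sym (trans (cong toℕ vx≡p) p≡0)) 0<A)
    y∈B : y ∈ˢ B
    y∈B = proj₂ (hB y) (subst (_< ∣ B ∣) (sym (trans (cong toℕ
      (trans (lookup-flip v y) (trans (cong (PC.transpose p q) vy≡q) (transpose-j p q)))) p≡0)) 0<B)
    y∉A : y ∉ˢ A
    y∉A y∈A = <⇒≱ A<Z (subst (_≤ ∣ A ∣) (trans (cong (suc ∘ toℕ) vy≡q) q+1≡) (proj₁ (hA y) y∈A))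
    x∉B : x ∉ˢ B
    x∉B x∈B = <⇒≱ B<Z (subst (_≤ ∣ B ∣) (trans (cong (suc ∘ toℕ)
      (trans (lookup-flip v x) (trans (cong (PC.transpose p q) vx≡p) (transpose-i p q)))) q+1≡) (proj₁ (hB x) x∈B))

-- Summation over a list

∑ˡ : List X → (X → ℕ) → ℕ
∑ˡ []       f = 0
∑ˡ (x ∷ xs) f = f x + ∑ˡ xs f

∑ˡ-mono : (xs : List X) {f g : X → ℕ} → (∀ {x} → x ∈ xs → f x ≤ g x) → ∑ˡ xs f ≤ ∑ˡ xs g
∑ˡ-mono []       f≤g = z≤n
∑ˡ-mono (x ∷ xs) f≤g = +-mono-≤ (f≤g (here refl)) (∑ˡ-mono xs (f≤g ∘ there))

∑ˡ-cong : (xs : List X) {f g : X → ℕ} → (∀ x → f x ≡ g x) → ∑ˡ xs f ≡ ∑ˡ xs g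
∑ˡ-cong []       f≡g = refl
∑ˡ-cong (x ∷ xs) f≡g = cong₂ _+_ (f≡g x) (∑ˡ-cong xs f≡g)

∑ˡ-distrib-+ : (xs : List X) (f g : X → ℕ) → ∑ˡ xs (λ x → f x + g x) ≡ ∑ˡ xs f + ∑ˡ xs g
∑ˡ-distrib-+ []       f g = refl
∑ˡ-distrib-+ (x ∷ xs) f g rewrite ∑ˡ-distrib-+ xs f g =
  solve 4 (λ a b c d → (a :+ b) :+ (c :+ d) := (a :+ c) :+ (b :+ d)) refl (f x) (g x) (∑ˡ xs f) (∑ˡ xs g)
  where open +-*-Solver

∑ˡ-*ʳ : (xs : List X) (f : X → ℕ) (c : ℕ) → ∑ˡ xs (λ x → f x * c) ≡ ∑ˡ xs f * c
∑ˡ-*ʳ []       f c = refl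
∑ˡ-*ʳ (x ∷ xs) f c = trans (cong (f x * c +_) (∑ˡ-*ʳ xs f c)) (sym (*-distribʳ-+ c (f x) (∑ˡ xs f)))

∑ˡ-zero : (xs : List X) {f : X → ℕ} → (∀ {x} → x ∈ xs → f x ≡ 0) → ∑ˡ xs f ≡ 0
∑ˡ-zero []       f≡0 = refl
∑ˡ-zero (x ∷ xs) f≡0 = cong₂ _+_ (f≡0 (here refl)) (∑ˡ-zero xs (f≡0 ∘ there))

∑ˡ-term : {xs : List X} {x : X} (f : X → ℕ) → x ∈ xs → f x ≤ ∑ˡ xs f
∑ˡ-term f (here refl) = m≤m+n _ _
∑ˡ-term f (there x∈)  = ≤-trans (∑ˡ-term f x∈) (m≤n+m _ _)

∑ˡ-single : {xs : List X} {x : X} (f : X → ℕ) → Unique xs → x ∈ xs →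
            (∀ {y} → y ∈ xs → y ≢ x → f y ≡ 0) → ∑ˡ xs f ≤ f x
∑ˡ-single {xs = x ∷ xs} f (x∉ ∷ _) (here refl) f≡0
  rewrite ∑ˡ-zero xs {f} (λ y∈ → f≡0 (there y∈) (All.lookup x∉ y∈ ∘ sym)) = ≤-reflexive (+-identityʳ (f x))
∑ˡ-single {xs = y ∷ xs} f (y∉ ∷ u) (there x∈) f≡0
  rewrite f≡0 (here refl) (All.lookup y∉ x∈) = ∑ˡ-single f u x∈ (f≡0 ∘ there)

𝟙≤1 : {P : Set} (P? : Dec P) → 𝟙 P? ≤ 1
𝟙≤1 (yes _) = ≤-refl
𝟙≤1 (no _)  = z≤n

∑ˡ-𝟙≤1 : {xs : List X} {P : X → Set} (P? : ∀ x → Dec (P x)) → Unique xs →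
         (∀ {x y} → x ∈ xs → y ∈ xs → P x → P y → x ≡ y) → ∑ˡ xs (𝟙 ∘ P?) ≤ 1
∑ˡ-𝟙≤1 {xs = xs} P? u P-unique with any? P? xs
... | no ¬P = ≤-trans (≤-reflexive (∑ˡ-zero xs λ x∈ → 𝟙-false (P? _) λ Px → ¬P (lose x∈ Px))) z≤n
... | yes ∃P = let x , x∈ , Px = find ∃P in
  ≤-trans (∑ˡ-single (𝟙 ∘ P?) u x∈ λ y∈ y≢x → 𝟙-false (P? _) λ Py → y≢x (P-unique y∈ x∈ Py Px)) (𝟙≤1 (P? x))

∑ᶜ-∑ˡ : (xs : List X) (f : Chain n → X → ℕ) → ∑ᶜ (λ v → ∑ˡ xs (f v)) ≡ ∑ˡ xs (λ x → ∑ᶜ λ v → f v x)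
∑ᶜ-∑ˡ {n = n} []       f = trans (∑ᶜ-const n 0) (*-zeroʳ (n !))
∑ᶜ-∑ˡ {n = n} (x ∷ xs) f = trans (∑ᶜ-distrib-+ (λ v → f v x) (λ v → ∑ˡ xs (f v)))
                                 (cong (∑ᶜ (λ v → f v x) +_) (∑ᶜ-∑ˡ xs f))

∑ˡ-𝟙≡length : {P : X → Set} (P? : ∀ x → Dec (P x)) (xs : List X) → ∑ˡ xs (𝟙 ∘ P?) ≡ length (filter P? xs)
∑ˡ-𝟙≡length P? []       = refl
∑ˡ-𝟙≡length P? (x ∷ xs) with P? x
... | yes _ = cong suc (∑ˡ-𝟙≡length P? xs)
... | no  _ = ∑ˡ-𝟙≡length P? xs

-- Chains in a family

⊆∧≢⇒⊂ : {A B : Subset n} → A ⊆ B → A ≢ B → A ⊂ B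
⊆∧≢⇒⊂ {A = A} {B} A⊆B A≢B with Fin.any? (λ x → (x ∈? B) ×-dec ¬? (x ∈? A))
... | yes w = A⊆B , w
... | no ¬w = contradiction (⊆-antisym A⊆B λ {x} x∈B → decidable-stable (x ∈? A) λ x∉A → ¬w (x , x∈B , x∉A)) A≢B

⊂⇒≢ : {A B : Subset n} → A ⊂ B → A ≢ B
⊂⇒≢ A⊂B A≡B = ⊂-irref A≡B A⊂B

⊂⇒⊉ : {A B : Subset n} → A ⊂ B → ¬ (B ⊆ A)
⊂⇒⊉ (_ , x , x∈B , x∉A) B⊆A = x∉A (B⊆A x∈B)

⊈⇒⊃ : {A B : Subset n} → Comparable A B → ¬ (A ⊆ B) → B ⊂ A
⊈⇒⊃ (inj₁ A⊆B) A⊈B = contradiction (λ {x} → A⊆B {x}) A⊈B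
⊈⇒⊃ (inj₂ B⊆A) A⊈B = ⊆∧≢⇒⊂ B⊆A λ { refl → A⊈B id }

⊂-or-⊇ : {A B : Subset n} → Comparable A B → A ⊂ B ⊎ B ⊆ A
⊂-or-⊇ {A = A} {B} A~B with B ⊆? A
... | yes B⊆A = inj₂ B⊆A
... | no B⊈A  = inj₁ (⊈⇒⊃ (swap A~B) B⊈A)

insertˢ : Subset n → List (Subset n) → List (Subset n)
insertˢ A []      = A ∷ []
insertˢ A (B ∷ G) with A ⊆? B
... | yes _ = A ∷ B ∷ G
... | no  _ = B ∷ insertˢ A G

insertˢ-All : {P : Subset n → Set} {A : Subset n} {G : List (Subset n)} → P A → All P G → All P (insertˢ A G)
insertˢ-All pA []       = pA ∷ []
insertˢ-All {A = A} {B ∷ G} pA (pB ∷ pG) with A ⊆? B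
... | yes _ = pA ∷ pB ∷ pG
... | no  _ = pB ∷ insertˢ-All pA pG

insertˢ-length : (A : Subset n) (G : List (Subset n)) → length (insertˢ A G) ≡ suc (length G)
insertˢ-length A []      = refl
insertˢ-length A (B ∷ G) with A ⊆? B
... | yes _ = refl
... | no  _ = cong suc (insertˢ-length A G)

insertˢ-chain : {A : Subset n} {G : List (Subset n)} → AllPairs _⊂_ G →
                All (λ B → A ≢ B × Comparable A B) G → AllPairs _⊂_ (insertˢ A G)
insertˢ-chain []  [] = [] ∷ []
insertˢ-chain {A = A} {B ∷ G} (B⊂ ∷ G-chain) ((A≢B , A~B) ∷ A~G) with A ⊆? B
... | yes A⊆B = (A⊂B ∷ All.map (⊂-trans A⊂B) B⊂) ∷ B⊂ ∷ G-chain
  where A⊂B = ⊆∧≢⇒⊂ A⊆B A≢B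
... | no A⊈B  = insertˢ-All B⊂A B⊂ ∷ insertˢ-chain G-chain A~G
  where B⊂A = ⊈⇒⊃ A~B A⊈B

-- Insertion sort by inclusion. A strictly increasing list supplies the linear part of a copy of
-- Y_k, and the preserved length turns its absence into a bound on a count.
sort-chain : (G : List (Subset n)) → Unique G → (∀ {A B} → A ∈ G → B ∈ G → Comparable A B) →
  ∃ λ G′ → AllPairs _⊂_ G′ × All (_∈ G) G′ × length G′ ≡ length G
sort-chain []      _        _  = [] , [] , [] , refl
sort-chain (A ∷ G) (A∉ ∷ u) G~ =
  let G′ , chain , G′⊆G , len = sort-chain G u λ A∈ B∈ → G~ (there A∈) (there B∈) in
  insertˢ A G′
  , insertˢ-chain chain (All.map (λ B∈ → All.lookup A∉ B∈ , G~ (here refl) (there B∈)) G′⊆G)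
  , insertˢ-All (here refl) (All.map there G′⊆G)
  , trans (insertˢ-length A G′) (cong suc len)

AllPairs-lookup : {R : X → X → Set} {xs : List X} → AllPairs R xs →
                  {i j : Fin (length xs)} → i Fin.< j → R (List.lookup xs i) (List.lookup xs j)
AllPairs-lookup (r ∷ _)  {zero}  {suc j} _         = All.lookup r (∈-lookup j)
AllPairs-lookup (_ ∷ rs) {suc i} {suc j} (s≤s i<j) = AllPairs-lookup rs i<j

comparable? : (A B : Subset n) → Dec (Comparable A B)
comparable? A B = (A ⊆? B) ⊎-dec (B ⊆? A)

-- Upper and lower linear members, and induced copies of Y

module _ (F : Family n) where

  -- Quantifying by `All` over the list `F` makes both properties decidable, so that they can be
  -- counted by indicators.
  UpperLinear LowerLinear : Subset n → Set
  UpperLinear A = All (λ B → All (λ C → A ⊂ B → A ⊂ C → Comparable B C) F) F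
  LowerLinear A = All (λ B → All (λ C → B ⊂ A → C ⊂ A → Comparable B C) F) F

  upperLinear? : ∀ A → Dec (UpperLinear A)
  upperLinear? A = all? (λ B → all? (λ C → (A ⊂? B) →-dec ((A ⊂? C) →-dec comparable? B C)) F) F

  lowerLinear? : ∀ A → Dec (LowerLinear A)
  lowerLinear? A = all? (λ B → all? (λ C → (B ⊂? A) →-dec ((C ⊂? A) →-dec comparable? B C)) F) F

module _ {F : Family n} where

  upperLinear⁺ : ∀ {A} → (∀ {B C} → B ∈ F → C ∈ F → A ⊂ B → A ⊂ C → Comparable B C) → UpperLinear F A
  upperLinear⁺ f = All.tabulate λ B∈ → All.tabulate λ C∈ → f B∈ C∈

  lowerLinear⁺ : ∀ {A} → (∀ {B C} → B ∈ F → C ∈ F → B ⊂ A → C ⊂ A → Comparable B C) → LowerLinear F A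
  lowerLinear⁺ f = All.tabulate λ B∈ → All.tabulate λ C∈ → f B∈ C∈

  upperLinear⁻ : ∀ {A B C} → UpperLinear F A → B ∈ F → C ∈ F → A ⊂ B → A ⊂ C → Comparable B C
  upperLinear⁻ u B∈ C∈ = All.lookup (All.lookup u B∈) C∈

  lowerLinear⁻ : ∀ {A B C} → LowerLinear F A → B ∈ F → C ∈ F → B ⊂ A → C ⊂ A → Comparable B C
  lowerLinear⁻ l B∈ C∈ = All.lookup (All.lookup l B∈) C∈

  -- Whatever lies strictly above `B` lies strictly above `A`.
  upperLinear-up : ∀ {A B} → A ⊆ B → UpperLinear F A → UpperLinear F B
  upperLinear-up A⊆B u = upperLinear⁺ λ C∈ D∈ B⊂C B⊂D →
    upperLinear⁻ u C∈ D∈ (⊆-⊂-trans A⊆B B⊂C) (⊆-⊂-trans A⊆B B⊂D)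

  -- Incomparability of `B` and `C` serves twice: it makes them distinct, and it excludes an
  -- inclusion between them, as an induced copy requires.
  induced-Y : ∀ {k} (α : Fin k → Subset n) → (∀ i → α i ∈ F) → (∀ {i j} → i Fin.< j → α i ⊂ α j) →
    ∀ {B C} → B ∈ F → C ∈ F → (∀ i → α i ⊂ B) → (∀ i → α i ⊂ C) → ¬ Comparable B C →
    InducedIn (Yel k) _<Y_ F
  induced-Y {k} α α∈ α-mono {B} {C} B∈ C∈ α⊂B α⊂C B≁C = β , β-injective , β∈ , λ p q → mk⇔ (β-mono p q) (β-cancel p q)
    where
    β : Yel k → Subset n
    β (xe i) = α i
    β y₁     = B
    β y₂     = C
    β∈ : ∀ p → β p ∈ F
    β∈ (xe i) = α∈ i
    β∈ y₁     = B∈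
    β∈ y₂     = C∈
    B≢C : B ≢ C
    B≢C refl = B≁C (inj₁ id)
    β-injective : ∀ {p q} → β p ≡ β q → p ≡ q
    β-injective {xe i} {xe j} eq with Fin.<-cmp i j
    ... | tri< i<j _ _  = contradiction eq (⊂⇒≢ (α-mono i<j))
    ... | tri≈ _ refl _ = refl
    ... | tri> _ _ j<i  = contradiction (sym eq) (⊂⇒≢ (α-mono j<i))
    β-injective {xe i} {y₁} eq = contradiction eq (⊂⇒≢ (α⊂B i))
    β-injective {xe i} {y₂} eq = contradiction eq (⊂⇒≢ (α⊂C i))
    β-injective {y₁} {xe j} eq = contradiction (sym eq) (⊂⇒≢ (α⊂B j))
    β-injective {y₂} {xe j} eq = contradiction (sym eq) (⊂⇒≢ (α⊂C j))
    β-injective {y₁} {y₁} eq = refl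
    β-injective {y₁} {y₂} eq = contradiction eq B≢C
    β-injective {y₂} {y₁} eq = contradiction (sym eq) B≢C
    β-injective {y₂} {y₂} eq = refl
    β-mono : ∀ p q → p <Y q → β p ⊂ β q
    β-mono _ _ (x<x i<j)  = α-mono i<j
    β-mono _ _ (x<y₁ {i}) = α⊂B i
    β-mono _ _ (x<y₂ {i}) = α⊂C i
    β-cancel : ∀ p q → β p ⊂ β q → p <Y q
    β-cancel (xe i) (xe j) lt with Fin.<-cmp i j
    ... | tri< i<j _ _  = x<x i<j
    ... | tri≈ _ refl _ = contradiction lt (⊂-irref refl)
    ... | tri> _ _ j<i  = contradiction lt (⊂-asymmetric (α-mono j<i))
    β-cancel (xe i) y₁ _ = x<y₁
    β-cancel (xe i) y₂ _ = x<y₂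
    β-cancel y₁ (xe j) lt = contradiction lt (⊂-asymmetric (α⊂B j))
    β-cancel y₂ (xe j) lt = contradiction lt (⊂-asymmetric (α⊂C j))
    β-cancel y₁ y₁ lt = contradiction lt (⊂-irref refl)
    β-cancel y₁ y₂ lt = ⊥-elim (B≁C (inj₁ (proj₁ lt)))
    β-cancel y₂ y₁ lt = ⊥-elim (B≁C (inj₂ (proj₁ lt)))
    β-cancel y₂ y₂ lt = contradiction lt (⊂-irref refl)

  -- Two incomparable members above the last set of the chain would lie above all of it and complete
  -- it to an induced Y.
  chain-top-upperLinear : ∀ {k} (α : Fin (suc k) → Subset n) → ¬ InducedIn (Yel (suc k)) _<Y_ F →
    (∀ i → α i ∈ F) → (∀ {i j} → i Fin.< j → α i ⊂ α j) → UpperLinear F (α (fromℕ k))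
  chain-top-upperLinear {k} α ¬Y α∈ α-mono = upperLinear⁺ λ {B} {C} B∈ C∈ top⊂B top⊂C →
    decidable-stable (comparable? B C) λ B≁C → ¬Y
      (induced-Y α α∈ α-mono B∈ C∈ (λ i → ⊆-⊂-trans (⊆top i) top⊂B) (λ i → ⊆-⊂-trans (⊆top i) top⊂C) B≁C)
    where
    ⊆top : ∀ i → α i ⊆ α (fromℕ k)
    ⊆top i with Fin.<-cmp i (fromℕ k)
    ... | tri< i<k _ _  = proj₁ (α-mono i<k)
    ... | tri≈ _ refl _ = id
    ... | tri> _ _ i>k  = contradiction (subst (toℕ i ≤_) (sym (toℕ-fromℕ k)) (toℕ≤pred[n] i)) (<⇒≱ i>k)

  -- If the chain cut out by `Q` had k + 1 elements, the first k + 1 of them in sorted order would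
  -- end in an upper linear member. The forbidden poset has index k + 1 here, so avoiding Y_k gives
  -- the bound k - 1.
  linear-part-bound : ∀ {k} → Unique F → ¬ InducedIn (Yel (suc k)) _<Y_ F →
    {Q : Subset n → Set} (Q? : ∀ A → Dec (Q A)) →
    (∀ {A B} → A ∈ F → B ∈ F → Q A → Q B → Comparable A B) →
    (∀ {A} → A ∈ F → Q A → ¬ UpperLinear F A) →
    ∑ˡ F (𝟙 ∘ Q?) ≤ k
  linear-part-bound {k} u ¬Y {Q} Q? Q-comparable Q-¬upper
    with G , chain , G⊆ , len ← sort-chain (filter Q? F) (Unique.filter⁺ Q? u)
           (λ A∈ B∈ → let A∈F , QA = ∈-filter⁻ Q? A∈ ; B∈F , QB = ∈-filter⁻ Q? B∈ in Q-comparable A∈F B∈F QA QB)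
    = subst (_≤ k) (sym (trans (∑ˡ-𝟙≡length Q? F) (sym len))) (≮⇒≥ too-long)
    where
    too-long : ¬ (suc k ≤ length G)
    too-long k<G = let A∈F , QA = α-spec (fromℕ k) in
      Q-¬upper A∈F QA (chain-top-upperLinear α ¬Y (proj₁ ∘ α-spec) α-mono)
      where
      α : Fin (suc k) → Subset n
      α i = List.lookup G (inject≤ i k<G)
      α-spec : ∀ i → α i ∈ F × Q (α i)
      α-spec i = ∈-filter⁻ Q? (All.lookup G⊆ (∈-lookup (inject≤ i k<G)))
      α-mono : ∀ {i j} → i Fin.< j → α i ⊂ α j
      α-mono {i} {j} i<j = AllPairs-lookup chain
        (subst₂ _<_ (sym (toℕ-inject≤ i k<G)) (sym (toℕ-inject≤ j k<G)) i<j)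

-- Discharging

∣p∣≡0⇒p≡⊥ : (A : Subset n) → ∣ A ∣ ≡ 0 → A ≡ ⊥
∣p∣≡0⇒p≡⊥ []            _  = refl
∣p∣≡0⇒p≡⊥ (outside ∷ A) eq = cong (outside ∷_) (∣p∣≡0⇒p≡⊥ A eq)

module _ (Z : Subset n) (0<Z : 0 < ∣ Z ∣) where

  -- Flipping preserves `∑ᶜ`, so in an estimate that pairs a chain with its flip both terms have the
  -- same sum.
  ∑ᶜ-flip-≤ : (f g : Chain n → ℕ) → (∀ v → Onto v → f v ≤ g v + g (flip Z 0<Z v)) → ∑ᶜ f ≤ ∑ᶜ g + ∑ᶜ g
  ∑ᶜ-flip-≤ f g f≤ = begin
    ∑ᶜ f                                      ≤⟨ ∑ᶜ-mono f≤ ⟩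
    ∑ᶜ (λ v → g v + g (flip Z 0<Z v))         ≡⟨ ∑ᶜ-distrib-+ g (g ∘ flip Z 0<Z) ⟩
    ∑ᶜ g + ∑ᶜ (g ∘ flip Z 0<Z)                ≡⟨ cong (∑ᶜ g +_) (∑ᶜ-flip Z 0<Z g) ⟩
    ∑ᶜ g + ∑ᶜ g                               ∎
    where open ≤-Reasoning

  ∑ᶜ-flip-≥ : (f g : Chain n → ℕ) → (∀ v → Onto v → f v + f (flip Z 0<Z v) ≤ g v) → ∑ᶜ f + ∑ᶜ f ≤ ∑ᶜ g
  ∑ᶜ-flip-≥ f g f≤ = begin
    ∑ᶜ f + ∑ᶜ f                               ≡⟨ cong (∑ᶜ f +_) (∑ᶜ-flip Z 0<Z f) ⟨
    ∑ᶜ f + ∑ᶜ (f ∘ flip Z 0<Z)                ≡⟨ ∑ᶜ-distrib-+ f (f ∘ flip Z 0<Z) ⟨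
    ∑ᶜ (λ v → f v + f (flip Z 0<Z v))         ≤⟨ ∑ᶜ-mono f≤ ⟩
    ∑ᶜ g                                      ∎
    where open ≤-Reasoning

∑ᶜ-hit-× : {P : Subset n → Set} (P? : ∀ A → Dec (P A)) (A : Subset n) →
           ∑ᶜ (λ v → 𝟙 (hit? v A ×-dec P? A)) ≡ 𝟙 (P? A) * hits A
∑ᶜ-hit-× P? A = begin
  ∑ᶜ (λ v → 𝟙 (hit? v A ×-dec P? A))
    ≡⟨ ∑ᶜ-cong (λ v → 𝟙-× (P? A) (hit? v A) (hit? v A ×-dec P? A) Product.swap Product.swap) ⟩
  ∑ᶜ (λ v → 𝟙 (hit? v A) * 𝟙 (P? A))  ≡⟨ ∑ᶜ-*ʳ (λ v → 𝟙 (hit? v A)) (𝟙 (P? A)) ⟩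
  ∑ᶜ (λ v → 𝟙 (hit? v A)) * 𝟙 (P? A)  ≡⟨ cong (_* 𝟙 (P? A)) (∑ᶜ-hit A) ⟩
  hits A * 𝟙 (P? A)                   ≡⟨ *-comm (hits A) (𝟙 (P? A)) ⟩
  𝟙 (P? A) * hits A                   ∎
  where open ≡-Reasoning

largest : {P : Subset n → Set} (P? : ∀ A → Dec (P A)) (xs : List (Subset n)) →
  (∃ λ Z → Z ∈ xs × P Z × (∀ {A} → A ∈ xs → P A → ∣ A ∣ ≤ ∣ Z ∣)) ⊎ (∀ {A} → A ∈ xs → ¬ P A)
largest P? []       = inj₂ λ ()
largest P? (B ∷ xs) with P? B | largest P? xs
... | no ¬PB | inj₂ none = inj₂ λ { (here refl) → ¬PB ; (there A∈) → none A∈ }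
... | yes PB | inj₂ none = inj₁ (B , here refl , PB , λ { (here refl) _ → ≤-refl ; (there A∈) PA → contradiction PA (none A∈) })
... | no ¬PB | inj₁ (Z , Z∈ , PZ , max) = inj₁ (Z , there Z∈ , PZ , λ { (here refl) PB → contradiction PB ¬PB ; (there A∈) → max A∈ })
... | yes PB | inj₁ (Z , Z∈ , PZ , max) with ≤-total ∣ B ∣ ∣ Z ∣
...   | inj₁ B≤Z = inj₁ (Z , there Z∈ , PZ , λ { (here refl) _ → B≤Z ; (there A∈) → max A∈ })
...   | inj₂ Z≤B = inj₁ (B , here refl , PB , λ { (here refl) _ → ≤-refl ; (there A∈) PA → ≤-trans (max A∈ PA) Z≤B })

-- The bound for one bracket, with k = 2 + m

module Half {m : ℕ} (F : Family n) (F! : Unique F)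
            (¬Y : ¬ InducedIn (Yel (2 + m)) _<Y_ F) (⊥∉F : ⊥ ∉ F) where

  nonempty : ∀ {A} → A ∈ F → 0 < ∣ A ∣
  nonempty {A} A∈ = n≢0⇒n>0 λ eq → ⊥∉F (subst (_∈ F) (∣p∣≡0⇒p≡⊥ A eq) A∈)

  U L : Subset n → Set
  U = UpperLinear F
  L = LowerLinear F

  -- A chain either has a core, or has lower linear members but no core, or has no lower linear
  -- member. `Lowest` serves the first kind; on a chain of the second kind, the largest lower linear
  -- member is `Top`.
  Core Lowest Top : Chain n → Subset n → Set
  Core   v Z = Hit v Z × L Z × U Z
  Lowest v Z = Core v Z × All (λ A → ¬ (Hit v A × A ⊂ Z)) F
  Top    v Z = Hit v Z × (L Z × ¬ U Z) × All (λ A → ¬ (Hit v A × L A × Z ⊂ A)) F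

  NonUpper? : ∀ v A → Dec (Hit v A × ¬ U A)
  NonUpper? v A = hit? v A ×-dec ¬? (upperLinear? F A)

  Lower? : ∀ v A → Dec (Hit v A × L A)
  Lower? v A = hit? v A ×-dec lowerLinear? F A

  core? : ∀ v Z → Dec (Core v Z)
  core? v Z = hit? v Z ×-dec (lowerLinear? F Z ×-dec upperLinear? F Z)

  lowest? : ∀ v Z → Dec (Lowest v Z)
  lowest? v Z = core? v Z ×-dec all? (λ A → ¬? (hit? v A ×-dec (A ⊂? Z))) F

  top? : ∀ v Z → Dec (Top v Z)
  top? v Z = hit? v Z ×-dec ((lowerLinear? F Z ×-dec ¬? (upperLinear? F Z)) ×-dec
             all? (λ A → ¬? (hit? v A ×-dec (lowerLinear? F A ×-dec (Z ⊂? A)))) F)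

  nonUpper lower cores lowests : Chain n → ℕ
  nonUpper v = ∑ˡ F λ A → 𝟙 (NonUpper? v A)
  lower    v = ∑ˡ F λ A → 𝟙 (Lower? v A)
  cores    v = ∑ˡ F λ Z → 𝟙 (core? v Z)
  lowests  v = ∑ˡ F λ Z → 𝟙 (lowest? v Z)

  below? : ∀ (v : Chain n) Z A → Dec (Hit v A × A ⊂ Z)
  below? v Z A = hit? v A ×-dec (A ⊂? Z)

  hitsBelow : Chain n → Subset n → ℕ
  hitsBelow v Z = ∑ˡ F λ A → 𝟙 (below? v Z A)

  membersBelow : Subset n → ℕ
  membersBelow Z = ∑ˡ F λ A → 𝟙 (A ⊂? Z)

  -- If a member `A` below the core `Z` is on `v`, then no member below `Z` is on the flipped chain:
  -- it would be comparable to `A` because `Z` is lower linear. So `Z` is lowest on `v` or on its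
  -- flip.
  core-flip : ∀ {Z} → Z ∈ F → ∑ᶜ (λ v → 𝟙 (core? v Z)) ≤ ∑ᶜ (λ v → 𝟙 (lowest? v Z)) + ∑ᶜ (λ v → 𝟙 (lowest? v Z))
  core-flip {Z} Z∈ = ∑ᶜ-flip-≤ Z 0<Z (λ v → 𝟙 (core? v Z)) (λ v → 𝟙 (lowest? v Z)) λ v v-onto →
    𝟙-⊎ (core? v Z) (lowest? v Z) (lowest? (flip Z 0<Z v) Z) (split v v-onto)
    where
    0<Z = nonempty Z∈
    split : ∀ v → Onto v → Core v Z → Lowest v Z ⊎ Lowest (flip Z 0<Z v) Z
    split v v-onto c@(hZ , lZ , uZ) with any? (below? v Z) F
    ... | no none  = inj₁ (c , All.tabulate λ A∈ b → none (lose A∈ b))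
    ... | yes some with A , A∈ , (hA , A⊂Z) ← find some =
      inj₂ ((flip-hit Z 0<Z v ≤-refl hZ , lZ , uZ) , All.tabulate λ {B} B∈ (hB , B⊂Z) →
        flip-disjoint Z 0<Z v v-onto (nonempty A∈) (nonempty B∈) (p⊂q⇒∣p∣<∣q∣ A⊂Z) (p⊂q⇒∣p∣<∣q∣ B⊂Z) hA hB
          (lowerLinear⁻ lZ A∈ B∈ A⊂Z B⊂Z))

  -- `Top` only concerns sets of size at least ∣ Z ∣, so it is invariant under the flip. A member
  -- below `Z` is comparable to itself, hence it is on at most one of the two chains.
  top-flip : ∀ {Z} → Z ∈ F →
    ∑ᶜ (λ v → 𝟙 (top? v Z) * hitsBelow v Z) + ∑ᶜ (λ v → 𝟙 (top? v Z) * hitsBelow v Z) ≤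
    ∑ᶜ (λ v → 𝟙 (top? v Z) * membersBelow Z)
  top-flip {Z} Z∈ = ∑ᶜ-flip-≥ Z 0<Z (λ v → 𝟙 (top? v Z) * hitsBelow v Z) _ λ v v-onto → begin
    𝟙 (top? v Z) * hitsBelow v Z + 𝟙 (top? (φ v) Z) * hitsBelow (φ v) Z
      ≡⟨ cong (λ t → 𝟙 (top? v Z) * hitsBelow v Z + t * hitsBelow (φ v) Z)
              (𝟙-cong (top? (φ v) Z) (top? v Z) (from v) (to v)) ⟩
    𝟙 (top? v Z) * hitsBelow v Z + 𝟙 (top? v Z) * hitsBelow (φ v) Z
      ≡⟨ *-distribˡ-+ (𝟙 (top? v Z)) (hitsBelow v Z) (hitsBelow (φ v) Z) ⟨
    𝟙 (top? v Z) * (hitsBelow v Z + hitsBelow (φ v) Z)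
      ≤⟨ *-monoʳ-≤ (𝟙 (top? v Z)) (both v v-onto) ⟩
    𝟙 (top? v Z) * membersBelow Z  ∎
    where
    open ≤-Reasoning
    0<Z = nonempty Z∈
    φ = flip Z 0<Z
    to : ∀ v → Top v Z → Top (φ v) Z
    to v (hZ , lu , none) = flip-hit Z 0<Z v ≤-refl hZ , lu , All.map
      (λ {A} ¬A (hA , lA , Z⊂A) → ¬A (flip-hit⁻ Z 0<Z v (p⊆q⇒∣p∣≤∣q∣ (proj₁ Z⊂A)) hA , lA , Z⊂A)) none
    from : ∀ v → Top (φ v) Z → Top v Z
    from v (hZ , lu , none) = flip-hit⁻ Z 0<Z v ≤-refl hZ , lu , All.map
      (λ {A} ¬A (hA , lA , Z⊂A) → ¬A (flip-hit Z 0<Z v (p⊆q⇒∣p∣≤∣q∣ (proj₁ Z⊂A)) hA , lA , Z⊂A)) none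
    both : ∀ v → Onto v → hitsBelow v Z + hitsBelow (φ v) Z ≤ membersBelow Z
    both v v-onto = ≤-trans (≤-reflexive (sym (∑ˡ-distrib-+ F (λ A → 𝟙 (below? v Z A)) (λ A → 𝟙 (below? (φ v) Z A)))))
      (∑ˡ-mono F λ {A} A∈ → 𝟙-disjoint (below? v Z A) (below? (φ v) Z A) (A ⊂? Z) proj₂ proj₂
        λ (hA , A⊂Z) (hA′ , _) → flip-disjoint Z 0<Z v v-onto (nonempty A∈) (nonempty A∈)
          (p⊂q⇒∣p∣<∣q∣ A⊂Z) (p⊂q⇒∣p∣<∣q∣ A⊂Z) hA hA′ (inj₁ id))

  nonUpper-bound : ∀ v → nonUpper v ≤ suc m
  nonUpper-bound v = linear-part-bound F! ¬Y (NonUpper? v) (λ _ _ (hA , _) (hB , _) → hit-comparable v hA hB) λ _ → proj₂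

  charge₀ : ∀ v → (∀ {A} → A ∈ F → ¬ (Hit v A × L A)) → nonUpper v + lower v ≤ 2 + m
  charge₀ v none rewrite ∑ˡ-zero F {λ A → 𝟙 (Lower? v A)} (λ {A} A∈ → 𝟙-false (Lower? v A) (none A∈))
                       | +-identityʳ (nonUpper v) = m≤n⇒m≤1+n (nonUpper-bound v)

  -- Let b = `hitsBelow v Z`, j = `membersBelow Z`, and let a count the members on `v` that contain
  -- `Z` and are not upper linear. Then `nonUpper v` is at most b + a; `lower v` is at most b + 1,
  -- since `Z` is the largest lower linear member on `v`; and j + a is at most k - 1.
  charge-top : ∀ v {Z} → Z ∈ F → Top v Z →
    nonUpper v + lower v + membersBelow Z ≤ 2 + m + (hitsBelow v Z + hitsBelow v Z)
  charge-top v {Z} Z∈ (hZ , (lZ , ¬uZ) , top) = begin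
    nonUpper v + lower v + membersBelow Z
      ≤⟨ +-monoˡ-≤ (membersBelow Z) (+-mono-≤ nonUpper≤ lower≤) ⟩
    hitsBelow v Z + above + (hitsBelow v Z + 1) + membersBelow Z
      ≡⟨ solve 3 (λ b a j → b :+ a :+ (b :+ con 1) :+ j := con 1 :+ (j :+ a) :+ (b :+ b)) refl
           (hitsBelow v Z) above (membersBelow Z) ⟩
    suc (membersBelow Z + above) + (hitsBelow v Z + hitsBelow v Z)
      ≤⟨ +-monoˡ-≤ (hitsBelow v Z + hitsBelow v Z) (s≤s chain-bound) ⟩
    2 + m + (hitsBelow v Z + hitsBelow v Z)  ∎
    where
    open ≤-Reasoning
    open +-*-Solver
    above? : ∀ A → Dec ((Hit v A × ¬ U A) × Z ⊆ A)
    above? A = NonUpper? v A ×-dec (Z ⊆? A)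
    above : ℕ
    above = ∑ˡ F λ A → 𝟙 (above? A)
    nonUpper≤ : nonUpper v ≤ hitsBelow v Z + above
    nonUpper≤ = ≤-trans
      (∑ˡ-mono F λ {A} A∈ → 𝟙-⊎ (NonUpper? v A) (below? v Z A) (above? A) below-or-above)
      (≤-reflexive (∑ˡ-distrib-+ F (λ A → 𝟙 (below? v Z A)) (λ A → 𝟙 (above? A))))
      where
      below-or-above : ∀ {A} → Hit v A × ¬ U A → (Hit v A × A ⊂ Z) ⊎ ((Hit v A × ¬ U A) × Z ⊆ A)
      below-or-above (hA , ¬uA) with ⊂-or-⊇ (hit-comparable v hA hZ)
      ... | inj₁ A⊂Z = inj₁ (hA , A⊂Z)
      ... | inj₂ Z⊆A = inj₂ ((hA , ¬uA) , Z⊆A)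
    lower≤ : lower v ≤ hitsBelow v Z + 1
    lower≤ = ≤-trans
      (∑ˡ-mono F λ {A} A∈ → 𝟙-⊎ (Lower? v A) (below? v Z A) (≡-dec _≟ᵇ_ A Z) (below-or-Z A∈))
      (≤-trans (≤-reflexive (∑ˡ-distrib-+ F (λ A → 𝟙 (below? v Z A)) (λ A → 𝟙 (≡-dec _≟ᵇ_ A Z))))
        (+-monoʳ-≤ (hitsBelow v Z) (∑ˡ-𝟙≤1 (λ A → ≡-dec _≟ᵇ_ A Z) F! λ _ _ A≡Z B≡Z → trans A≡Z (sym B≡Z))))
      where
      below-or-Z : ∀ {A} → A ∈ F → Hit v A × L A → (Hit v A × A ⊂ Z) ⊎ A ≡ Z
      below-or-Z {A} A∈ (hA , lA) with ⊂-or-⊇ (hit-comparable v hA hZ)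
      ... | inj₁ A⊂Z = inj₁ (hA , A⊂Z)
      ... | inj₂ Z⊆A with A ⊆? Z
      ...   | yes A⊆Z = inj₂ (⊆-antisym A⊆Z Z⊆A)
      ...   | no A⊈Z  = contradiction (hA , lA , ⊈⇒⊃ (hit-comparable v hA hZ) A⊈Z) (All.lookup top A∈)
    -- The members below `Z` form a chain because `Z` is lower linear, and none of them is upper
    -- linear because `Z` is not. Those counted by `above` continue this chain upwards.
    chain-bound : membersBelow Z + above ≤ suc m
    chain-bound = begin
      membersBelow Z + above
        ≡⟨ ∑ˡ-distrib-+ F (λ A → 𝟙 (A ⊂? Z)) (λ A → 𝟙 (above? A)) ⟨
      ∑ˡ F (λ A → 𝟙 (A ⊂? Z) + 𝟙 (above? A))
        ≤⟨ ∑ˡ-mono F (λ {A} A∈ → 𝟙-disjoint (A ⊂? Z) (above? A) ((A ⊂? Z) ⊎-dec above? A) inj₁ inj₂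
             λ A⊂Z (_ , Z⊆A) → ⊂⇒⊉ A⊂Z Z⊆A) ⟩
      ∑ˡ F (λ A → 𝟙 ((A ⊂? Z) ⊎-dec above? A))
        ≤⟨ linear-part-bound F! ¬Y (λ A → (A ⊂? Z) ⊎-dec above? A) comparable
             (λ { _ (inj₁ A⊂Z) uA → ¬uZ (upperLinear-up (proj₁ A⊂Z) uA) ; _ (inj₂ ((_ , ¬uA) , _)) → ¬uA }) ⟩
      suc m  ∎
      where
      comparable : ∀ {A B} → A ∈ F → B ∈ F → (A ⊂ Z) ⊎ ((Hit v A × ¬ U A) × Z ⊆ A) →
                   (B ⊂ Z) ⊎ ((Hit v B × ¬ U B) × Z ⊆ B) → Comparable A B
      comparable A∈ B∈ (inj₁ A⊂Z) (inj₁ B⊂Z) = lowerLinear⁻ lZ A∈ B∈ A⊂Z B⊂Z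
      comparable A∈ B∈ (inj₁ A⊂Z) (inj₂ (_ , Z⊆B)) = inj₁ (⊆-trans (proj₁ A⊂Z) Z⊆B)
      comparable A∈ B∈ (inj₂ (_ , Z⊆A)) (inj₁ B⊂Z) = inj₂ (⊆-trans (proj₁ B⊂Z) Z⊆A)
      comparable A∈ B∈ (inj₂ ((hA , _) , _)) (inj₂ ((hB , _) , _)) = hit-comparable v hA hB

  lowest-unique : ∀ v {A B} → A ∈ F → B ∈ F → Lowest v A → Lowest v B → A ≡ B
  lowest-unique v A∈ B∈ ((hA , _) , noneA) ((hB , _) , noneB) with ⊂-or-⊇ (hit-comparable v hA hB)
  ... | inj₁ A⊂B = contradiction (hA , A⊂B) (All.lookup noneB A∈)
  ... | inj₂ B⊆A with ⊂-or-⊇ (hit-comparable v hB hA)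
  ...   | inj₁ B⊂A = contradiction (hB , B⊂A) (All.lookup noneA B∈)
  ...   | inj₂ A⊆B = ⊆-antisym A⊆B B⊆A

  -- If the lowest member of F on v is a core, all members on v contain it and are upper linear.
  nonUpper-lowest : ∀ v → nonUpper v + lowests v * suc m ≤ suc m
  nonUpper-lowest v with any? (lowest? v) F
  ... | no none rewrite ∑ˡ-zero F {λ Z → 𝟙 (lowest? v Z)} (λ {Z} Z∈ → 𝟙-false (lowest? v Z) λ low → none (lose Z∈ low))
                      | +-identityʳ (nonUpper v) = nonUpper-bound v
  ... | yes some with Z , Z∈ , ((hZ , _ , uZ) , none) ← find some
    = ≤-trans (≤-reflexive (cong (_+ lowests v * suc m)
        (∑ˡ-zero F λ {A} A∈ → 𝟙-false (NonUpper? v A) λ (hA , ¬uA) → all-upper A∈ hA ¬uA)))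
      (≤-trans (*-monoˡ-≤ (suc m) (∑ˡ-𝟙≤1 (lowest? v) F! (lowest-unique v))) (≤-reflexive (*-identityˡ (suc m))))
    where
    all-upper : ∀ {A} → A ∈ F → Hit v A → ¬ ¬ U A
    all-upper A∈ hA ¬uA with ⊂-or-⊇ (hit-comparable v hA hZ)
    ... | inj₁ A⊂Z = All.lookup none A∈ (hA , A⊂Z)
    ... | inj₂ Z⊆A = ¬uA (upperLinear-up Z⊆A uZ)

  -- A lower linear member that is also upper linear is a core.
  lower≤nonUpper+cores : ∀ v → lower v ≤ nonUpper v + cores v
  lower≤nonUpper+cores v = ≤-trans
    (∑ˡ-mono F λ {A} A∈ → 𝟙-⊎ (Lower? v A) (NonUpper? v A) (core? v A) (upper-or-not A))
    (≤-reflexive (∑ˡ-distrib-+ F (λ A → 𝟙 (NonUpper? v A)) (λ A → 𝟙 (core? v A))))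
    where
    upper-or-not : ∀ A → Hit v A × L A → (Hit v A × ¬ U A) ⊎ Core v A
    upper-or-not A (hA , lA) with upperLinear? F A
    ... | yes uA = inj₂ (hA , lA , uA)
    ... | no ¬uA = inj₁ (hA , ¬uA)

  -- For a chain with N cores, using `nonUpper-lowest` twice leaves 2 (k - 1) + N. This is at most k
  -- + N (k - 1), because (N - 1) (k - 2) is nonnegative.
  charge-core : ∀ v → 0 < cores v →
    nonUpper v + lower v + (lowests v + lowests v) * suc m ≤ 2 + m + cores v * suc m
  charge-core v 0<N = begin
    c + lower v + (s + s) * suc m
      ≤⟨ +-monoˡ-≤ ((s + s) * suc m) (+-monoʳ-≤ c (lower≤nonUpper+cores v)) ⟩
    c + (c + cores v) + (s + s) * suc m
      ≡⟨ solve 4 (λ c N s m → c :+ (c :+ N) :+ (s :+ s) :* m := (c :+ s :* m) :+ (c :+ s :* m) :+ N)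
           refl c (cores v) s (suc m) ⟩
    (c + s * suc m) + (c + s * suc m) + cores v
      ≤⟨ +-monoˡ-≤ (cores v) (+-mono-≤ (nonUpper-lowest v) (nonUpper-lowest v)) ⟩
    suc m + suc m + cores v
      ≤⟨ arith (cores v) 0<N ⟩
    2 + m + cores v * suc m  ∎
    where
    open ≤-Reasoning
    open +-*-Solver
    c = nonUpper v
    s = lowests v
    arith : ∀ N → 0 < N → suc m + suc m + N ≤ 2 + m + N * suc m
    arith (suc N) _ = begin
      suc m + suc m + suc N  ≤⟨ +-monoʳ-≤ (suc m + suc m) (s≤s (m≤m*n N (suc m))) ⟩
      suc m + suc m + suc (N * suc m)
        ≡⟨ solve 2 (λ m n → m :+ m :+ (con 1 :+ n) := con 1 :+ m :+ (m :+ n)) refl (suc m) (N * suc m) ⟩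
      2 + m + suc N * suc m  ∎

  -- At most one member of `F` is `Top` on a given chain, so each sum has at most one nonzero term.
  -- Writing it as a sum over `F` allows the exchange with `∑ᶜ`.
  topCharge topDebt : Chain n → ℕ
  topCharge v = ∑ˡ F λ Z → 𝟙 (top? v Z) * hitsBelow v Z
  topDebt   v = ∑ˡ F λ Z → 𝟙 (top? v Z) * membersBelow Z

  -- In expectation topCharge + topCharge is at most topDebt and cores is at most twice lowests
  -- (by flipping), so the terms added on both sides cancel in favour of the bound 2 + m = k.
  charge : ∀ v → nonUpper v + lower v + (topDebt v + (lowests v + lowests v) * suc m)
               ≤ 2 + m + ((topCharge v + topCharge v) + cores v * suc m)
  charge v with any? (core? v) F
  ... | yes some with W , W∈ , cW@(hW , lW , uW) ← find some = begin
    φ + (topDebt v + S)   ≡⟨ cong (λ d → φ + (d + S)) (∑ˡ-zero F λ {Z} Z∈ → cong (_* membersBelow Z) (𝟙-false (top? v Z) (no-top Z∈))) ⟩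
    φ + S                 ≤⟨ charge-core v (≤-trans (≤-reflexive (sym (𝟙-true (core? v W) cW))) (∑ˡ-term (λ Z → 𝟙 (core? v Z)) W∈)) ⟩
    2 + m + cores v * suc m  ≤⟨ +-monoʳ-≤ (2 + m) (m≤n+m (cores v * suc m) (topCharge v + topCharge v)) ⟩
    2 + m + ((topCharge v + topCharge v) + cores v * suc m)  ∎
    where
    open ≤-Reasoning
    φ = nonUpper v + lower v
    S = (lowests v + lowests v) * suc m
    -- A `Top` strictly below the core `W` would not be the largest lower linear member; one that
    -- contains `W` would be upper linear.
    no-top : ∀ {Z} → Z ∈ F → ¬ Top v Z
    no-top Z∈ (hZ , (_ , ¬uZ) , none) with ⊂-or-⊇ (hit-comparable v hZ hW)
    ... | inj₁ Z⊂W = All.lookup none W∈ (hW , lW , Z⊂W)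
    ... | inj₂ W⊆Z = ¬uZ (upperLinear-up W⊆Z uW)
  ... | no none with largest (Lower? v) F
  ...   | inj₂ no-lower = begin
    φ + (topDebt v + (lowests v + lowests v) * suc m)  ≡⟨ cong₂ (λ d s → φ + (d + (s + s) * suc m))
      (∑ˡ-zero F λ {Z} Z∈ → cong (_* membersBelow Z) (𝟙-false (top? v Z) λ (hZ , (lZ , _) , _) → no-lower Z∈ (hZ , lZ)))
      (∑ˡ-zero F λ {Z} Z∈ → 𝟙-false (lowest? v Z) λ (cZ , _) → none (lose Z∈ cZ)) ⟩
    φ + 0                 ≡⟨ +-identityʳ φ ⟩
    φ                     ≤⟨ charge₀ v no-lower ⟩
    2 + m                 ≤⟨ m≤m+n (2 + m) _ ⟩
    2 + m + ((topCharge v + topCharge v) + cores v * suc m)  ∎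
    where
    open ≤-Reasoning
    φ = nonUpper v + lower v
  -- In the absence of cores the largest lower linear member is not upper linear, so it is the
  -- unique `Top` and accounts for all of `topDebt`.
  ...   | inj₁ (Z , Z∈ , (hZ , lZ) , max) = begin
    φ + (topDebt v + (lowests v + lowests v) * suc m)  ≡⟨ cong (λ s → φ + (topDebt v + (s + s) * suc m))
      (∑ˡ-zero F λ {A} A∈ → 𝟙-false (lowest? v A) λ (cA , _) → none (lose A∈ cA)) ⟩
    φ + (topDebt v + 0)   ≡⟨ cong (φ +_) (+-identityʳ (topDebt v)) ⟩
    φ + topDebt v         ≤⟨ +-monoʳ-≤ φ debt≤ ⟩
    φ + membersBelow Z    ≤⟨ charge-top v Z∈ topZ ⟩
    2 + m + (hitsBelow v Z + hitsBelow v Z)  ≤⟨ +-monoʳ-≤ (2 + m) (+-mono-≤ charge≥ charge≥) ⟩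
    2 + m + (topCharge v + topCharge v)  ≤⟨ +-monoʳ-≤ (2 + m) (m≤m+n (topCharge v + topCharge v) (cores v * suc m)) ⟩
    2 + m + ((topCharge v + topCharge v) + cores v * suc m)  ∎
    where
    open ≤-Reasoning
    φ = nonUpper v + lower v
    topZ : Top v Z
    topZ = hZ , (lZ , λ uZ → none (lose Z∈ (hZ , lZ , uZ))) ,
      All.tabulate λ A∈ (hA , lA , Z⊂A) → <⇒≱ (p⊂q⇒∣p∣<∣q∣ Z⊂A) (max A∈ (hA , lA))
    top-unique : ∀ {A} → A ∈ F → Top v A → A ≡ Z
    top-unique A∈ (hA , (lA , _) , noneA) with ⊂-or-⊇ (hit-comparable v hA hZ)
    ... | inj₁ A⊂Z = contradiction (hZ , lZ , A⊂Z) (All.lookup noneA Z∈)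
    ... | inj₂ Z⊆A = sym (⊆-antisym Z⊆A (hit-mono v hA hZ (max A∈ (hA , lA))))
    debt≤ : topDebt v ≤ membersBelow Z
    debt≤ = ≤-trans (∑ˡ-single (λ A → 𝟙 (top? v A) * membersBelow A) F! Z∈
        λ {A} A∈ A≢Z → cong (_* membersBelow A) (𝟙-false (top? v A) (A≢Z ∘ top-unique A∈)))
      (≤-reflexive (trans (cong (_* membersBelow Z) (𝟙-true (top? v Z) topZ)) (*-identityˡ (membersBelow Z))))
    charge≥ : hitsBelow v Z ≤ topCharge v
    charge≥ = ≤-trans
      (≤-reflexive (sym (trans (cong (_* hitsBelow v Z) (𝟙-true (top? v Z) topZ)) (*-identityˡ (hitsBelow v Z)))))
      (∑ˡ-term (λ A → 𝟙 (top? v A) * hitsBelow v A) Z∈)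

  topCharge≤topDebt : ∑ᶜ topCharge + ∑ᶜ topCharge ≤ ∑ᶜ topDebt
  topCharge≤topDebt = begin
    ∑ᶜ topCharge + ∑ᶜ topCharge
      ≡⟨ cong₂ _+_ eq eq ⟩
    ∑ˡ F t + ∑ˡ F t
      ≡⟨ ∑ˡ-distrib-+ F t t ⟨
    ∑ˡ F (λ Z → t Z + t Z)
      ≤⟨ ∑ˡ-mono F top-flip ⟩
    ∑ˡ F (λ Z → ∑ᶜ λ v → 𝟙 (top? v Z) * membersBelow Z)
      ≡⟨ ∑ᶜ-∑ˡ F (λ v Z → 𝟙 (top? v Z) * membersBelow Z) ⟨
    ∑ᶜ topDebt  ∎
    where
    open ≤-Reasoning
    t = λ Z → ∑ᶜ λ v → 𝟙 (top? v Z) * hitsBelow v Z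
    eq = ∑ᶜ-∑ˡ F (λ v Z → 𝟙 (top? v Z) * hitsBelow v Z)

  cores≤lowests : ∑ᶜ cores ≤ ∑ᶜ lowests + ∑ᶜ lowests
  cores≤lowests = begin
    ∑ᶜ cores
      ≡⟨ ∑ᶜ-∑ˡ F (λ v Z → 𝟙 (core? v Z)) ⟩
    ∑ˡ F (λ Z → ∑ᶜ λ v → 𝟙 (core? v Z))
      ≤⟨ ∑ˡ-mono F core-flip ⟩
    ∑ˡ F (λ Z → t Z + t Z)
      ≡⟨ ∑ˡ-distrib-+ F t t ⟩
    ∑ˡ F t + ∑ˡ F t
      ≡⟨ cong₂ _+_ eq eq ⟨
    ∑ᶜ lowests + ∑ᶜ lowests  ∎
    where
    open ≤-Reasoning
    t = λ Z → ∑ᶜ λ v → 𝟙 (lowest? v Z)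
    eq = ∑ᶜ-∑ˡ F (λ v Z → 𝟙 (lowest? v Z))

  -- Sum `charge` over all chains. The two flipping inequalities bound the correction on the right
  -- by the correction `D + W * suc m` on the left, which then cancels.
  total : ∑ᶜ nonUpper + ∑ᶜ lower ≤ n ! * (2 + m)
  total = +-cancelʳ-≤ (D + W * suc m) (∑ᶜ nonUpper + ∑ᶜ lower) (n ! * (2 + m)) (begin
    ∑ᶜ nonUpper + ∑ᶜ lower + (D + W * suc m)
      ≡⟨ cong₂ _+_ (sym (∑ᶜ-distrib-+ nonUpper lower)) (cong (D +_) (sym W≡)) ⟩
    ∑ᶜ (λ v → nonUpper v + lower v) + (D + ∑ᶜ (λ v → (lowests v + lowests v) * suc m))
      ≡⟨ cong (∑ᶜ (λ v → nonUpper v + lower v) +_) (sym (∑ᶜ-distrib-+ topDebt (λ v → (lowests v + lowests v) * suc m))) ⟩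
    ∑ᶜ (λ v → nonUpper v + lower v) + ∑ᶜ (λ v → topDebt v + (lowests v + lowests v) * suc m)
      ≡⟨ ∑ᶜ-distrib-+ (λ v → nonUpper v + lower v) (λ v → topDebt v + (lowests v + lowests v) * suc m) ⟨
    ∑ᶜ (λ v → nonUpper v + lower v + (topDebt v + (lowests v + lowests v) * suc m))
      ≤⟨ ∑ᶜ-mono (λ v _ → charge v) ⟩
    ∑ᶜ (λ v → 2 + m + ((topCharge v + topCharge v) + cores v * suc m))
      ≡⟨ ∑ᶜ-distrib-+ (λ _ → 2 + m) (λ v → (topCharge v + topCharge v) + cores v * suc m) ⟩
    ∑ᶜ {n} (λ _ → 2 + m) + ∑ᶜ (λ v → (topCharge v + topCharge v) + cores v * suc m)
      ≡⟨ cong₂ _+_ (∑ᶜ-const n (2 + m)) (∑ᶜ-distrib-+ (λ v → topCharge v + topCharge v) (λ v → cores v * suc m)) ⟩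
    n ! * (2 + m) + (∑ᶜ (λ v → topCharge v + topCharge v) + ∑ᶜ (λ v → cores v * suc m))
      ≡⟨ cong (n ! * (2 + m) +_) (cong₂ _+_ (∑ᶜ-distrib-+ topCharge topCharge) (∑ᶜ-*ʳ cores (suc m))) ⟩
    n ! * (2 + m) + ((∑ᶜ topCharge + ∑ᶜ topCharge) + ∑ᶜ cores * suc m)
      ≤⟨ +-monoʳ-≤ (n ! * (2 + m)) (+-mono-≤ topCharge≤topDebt (*-monoˡ-≤ (suc m) cores≤lowests)) ⟩
    n ! * (2 + m) + (D + W * suc m)  ∎)
    where
    open ≤-Reasoning
    D = ∑ᶜ topDebt
    W = ∑ᶜ lowests + ∑ᶜ lowests
    W≡ : ∑ᶜ (λ v → (lowests v + lowests v) * suc m) ≡ W * suc m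
    W≡ = trans (∑ᶜ-*ʳ (λ v → lowests v + lowests v) (suc m)) (cong (_* suc m) (∑ᶜ-distrib-+ lowests lowests))

  weight : Subset n → ℕ
  weight A = 𝟙 (¬? (upperLinear? F A)) + 𝟙 (lowerLinear? F A)

  half-bound : ∑ˡ F (λ A → weight A * hits A) ≤ n ! * (2 + m)
  half-bound = begin
    ∑ˡ F (λ A → weight A * hits A)
      ≡⟨ ∑ˡ-cong F (λ A → *-distribʳ-+ (hits A) (𝟙 (¬? (upperLinear? F A))) (𝟙 (lowerLinear? F A))) ⟩
    ∑ˡ F (λ A → 𝟙 (¬? (upperLinear? F A)) * hits A + 𝟙 (lowerLinear? F A) * hits A)
      ≡⟨ ∑ˡ-distrib-+ F (λ A → 𝟙 (¬? (upperLinear? F A)) * hits A) (λ A → 𝟙 (lowerLinear? F A) * hits A) ⟩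
    ∑ˡ F (λ A → 𝟙 (¬? (upperLinear? F A)) * hits A) + ∑ˡ F (λ A → 𝟙 (lowerLinear? F A) * hits A)
      ≡⟨ cong₂ _+_ (∑ˡ-cong F (∑ᶜ-hit-× (λ A → ¬? (upperLinear? F A)))) (∑ˡ-cong F (∑ᶜ-hit-× (lowerLinear? F))) ⟨
    ∑ˡ F (λ A → ∑ᶜ λ v → 𝟙 (NonUpper? v A)) + ∑ˡ F (λ A → ∑ᶜ λ v → 𝟙 (Lower? v A))
      ≡⟨ cong₂ _+_ (∑ᶜ-∑ˡ F (λ v A → 𝟙 (NonUpper? v A))) (∑ᶜ-∑ˡ F (λ v A → 𝟙 (Lower? v A))) ⟨
    ∑ᶜ nonUpper + ∑ᶜ lower
      ≤⟨ total ⟩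
    n ! * (2 + m)  ∎
    where open ≤-Reasoning

-- Complementation

∁-involutive : (A : Subset n) → ∁ (∁ A) ≡ A
∁-involutive A = trans (sym (map-∘ _ _ A)) (trans (map-cong not-involutive A) (map-id A))

∁-injective : {A B : Subset n} → ∁ A ≡ ∁ B → A ≡ B
∁-injective {A = A} {B} eq = trans (sym (∁-involutive A)) (trans (cong ∁ eq) (∁-involutive B))

∁-∈ : {F : Family n} {A : Subset n} → A ∈ map ∁ F → ∁ A ∈ F
∁-∈ A∈ with B , B∈ , refl ← ∈-map⁻ ∁ A∈ = subst (_∈ _) (sym (∁-involutive B)) B∈

induced-∁ : ∀ {k} {F : Family n} → InducedIn (Yel k) _<Y_ (map ∁ F) → InducedIn (Yel k) _<Y'_ F
induced-∁ (α , α-injective , α∈ , α-⇔) =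
  ∁ ∘ α , α-injective ∘ ∁-injective , ∁-∈ ∘ α∈ , λ p q → mk⇔
    (λ q<p → p⊂q⇒∁p⊃∁q (Equivalence.to (α-⇔ q p) q<p))
    (λ p⊂q → Equivalence.from (α-⇔ q p) (∁p⊂∁q⇒p⊃q p⊂q))

∁-comparable : {A B : Subset n} → Comparable A B → Comparable (∁ A) (∁ B)
∁-comparable (inj₁ A⊆B) = inj₂ (p⊆q⇒∁p⊇∁q A⊆B)
∁-comparable (inj₂ B⊆A) = inj₁ (p⊆q⇒∁p⊇∁q B⊆A)

comparable-∁⁻ : {A B : Subset n} → Comparable (∁ A) (∁ B) → Comparable A B
comparable-∁⁻ {A = A} {B} c = subst₂ Comparable (∁-involutive A) (∁-involutive B) (∁-comparable c)

upperLinear-∁ : {F : Family n} {A : Subset n} → UpperLinear (map ∁ F) (∁ A) → LowerLinear F A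
upperLinear-∁ u = lowerLinear⁺ λ B∈ C∈ B⊂A C⊂A → comparable-∁⁻
  (upperLinear⁻ u (∈-map⁺ ∁ B∈) (∈-map⁺ ∁ C∈) (p⊂q⇒∁p⊃∁q B⊂A) (p⊂q⇒∁p⊃∁q C⊂A))

lowerLinear-∁ : {F : Family n} {A : Subset n} → UpperLinear F A → LowerLinear (map ∁ F) (∁ A)
lowerLinear-∁ {F = F} {A} u = lowerLinear⁺ λ B∈ C∈ B⊂∁A C⊂∁A → comparable-∁⁻
  (upperLinear⁻ u (∁-∈ B∈) (∁-∈ C∈) (⊃-∁ B⊂∁A) (⊃-∁ C⊂∁A))
  where
  ⊃-∁ : ∀ {B} → B ⊂ ∁ A → A ⊂ ∁ B
  ⊃-∁ {B} B⊂∁A = subst (_⊂ ∁ B) (∁-involutive A) (p⊂q⇒∁p⊃∁q B⊂∁A)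

hits-∁ : (A : Subset n) → hits (∁ A) ≡ hits A
hits-∁ {n} A rewrite ∣∁p∣≡n∸∣p∣ A | m∸[m∸n]≡n (∣p∣≤n A) = *-comm ((n ∸ ∣ A ∣) !) (∣ A ∣ !)

∑ˡ-map : (g : X → Y) (xs : List X) (f : Y → ℕ) → ∑ˡ (map g xs) f ≡ ∑ˡ xs (f ∘ g)
∑ˡ-map g []       f = refl
∑ˡ-map g (x ∷ xs) f = cong (f (g x) +_) (∑ˡ-map g xs f)

-- The weights of `A` in `F` and of `∁ A` in the complementary family add up to at least 2, and both
-- sets lie on equally many chains. Adding the two half bounds therefore counts every member at
-- least twice.
weighted-bound : ∀ {m} (F : Family n) → Unique F →
  ¬ InducedIn (Yel (2 + m)) _<Y_ F → ¬ InducedIn (Yel (2 + m)) _<Y'_ F → ⊥ ∉ F → ⊤ ∉ F →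
  ∑ˡ F hits ≤ n ! * (2 + m)
weighted-bound {n} {m} F F! ¬Y ¬Y' ⊥∉F ⊤∉F = *-cancelˡ-≤ 2 (begin
  2 * ∑ˡ F hits
    ≡⟨ *-comm 2 (∑ˡ F hits) ⟩
  ∑ˡ F hits * 2
    ≡⟨ ∑ˡ-*ʳ F hits 2 ⟨
  ∑ˡ F (λ A → hits A * 2)
    ≤⟨ ∑ˡ-mono F (λ {A} _ → counted A) ⟩
  ∑ˡ F (λ A → H.weight A * hits A + H∁.weight (∁ A) * hits (∁ A))
    ≡⟨ ∑ˡ-distrib-+ F (λ A → H.weight A * hits A) (λ A → H∁.weight (∁ A) * hits (∁ A)) ⟩
  ∑ˡ F (λ A → H.weight A * hits A) + ∑ˡ F (λ A → H∁.weight (∁ A) * hits (∁ A))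
    ≡⟨ cong (∑ˡ F (λ A → H.weight A * hits A) +_) (∑ˡ-map ∁ F (λ A → H∁.weight A * hits A)) ⟨
  ∑ˡ F (λ A → H.weight A * hits A) + ∑ˡ (map ∁ F) (λ A → H∁.weight A * hits A)
    ≤⟨ +-mono-≤ H.half-bound H∁.half-bound ⟩
  n ! * (2 + m) + n ! * (2 + m)
    ≡⟨ cong (n ! * (2 + m) +_) (+-identityʳ (n ! * (2 + m))) ⟨
  2 * (n ! * (2 + m))  ∎)
  where
  open ≤-Reasoning
  ⊥∉∁F : ⊥ ∉ map ∁ F
  ⊥∉∁F ⊥∈ = ⊤∉F (subst (_∈ F) (map-replicate _ outside n) (∁-∈ ⊥∈))
  module H  = Half F F! ¬Y ⊥∉F
  module H∁ = Half {m = m} (map ∁ F) (Unique.map⁺ ∁-injective F!) (¬Y' ∘ induced-∁) ⊥∉∁F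
  -- Complementation turns what lies below `A` into what lies above `∁ A`, so one of the two
  -- indicators is 1.
  1≤lower+¬upper : ∀ A → 1 ≤ 𝟙 (lowerLinear? F A) + 𝟙 (¬? (upperLinear? (map ∁ F) (∁ A)))
  1≤lower+¬upper A with lowerLinear? F A
  ... | yes _ = s≤s z≤n
  ... | no ¬l = ≤-reflexive (sym (𝟙-true (¬? (upperLinear? (map ∁ F) (∁ A))) (¬l ∘ upperLinear-∁)))
  1≤¬upper+lower : ∀ A → 1 ≤ 𝟙 (¬? (upperLinear? F A)) + 𝟙 (lowerLinear? (map ∁ F) (∁ A))
  1≤¬upper+lower A with upperLinear? F A
  ... | no _  = s≤s z≤n
  ... | yes u = ≤-reflexive (sym (𝟙-true (lowerLinear? (map ∁ F) (∁ A)) (lowerLinear-∁ u)))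
  2≤weights : ∀ A → 2 ≤ H.weight A + H∁.weight (∁ A)
  2≤weights A = ≤-trans (+-mono-≤ (1≤¬upper+lower A) (1≤lower+¬upper A)) (≤-reflexive
    (solve 4 (λ a b c d → (a :+ d) :+ (b :+ c) := (a :+ b) :+ (c :+ d)) refl
      (𝟙 (¬? (upperLinear? F A))) (𝟙 (lowerLinear? F A))
      (𝟙 (¬? (upperLinear? (map ∁ F) (∁ A)))) (𝟙 (lowerLinear? (map ∁ F) (∁ A)))))
    where open +-*-Solver
  counted : ∀ A → hits A * 2 ≤ H.weight A * hits A + H∁.weight (∁ A) * hits (∁ A)
  counted A = begin
    hits A * 2                                         ≡⟨ *-comm (hits A) 2 ⟩
    2 * hits A                                         ≤⟨ *-monoˡ-≤ (hits A) (2≤weights A) ⟩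
    (H.weight A + H∁.weight (∁ A)) * hits A            ≡⟨ *-distribʳ-+ (hits A) (H.weight A) (H∁.weight (∁ A)) ⟩
    H.weight A * hits A + H∁.weight (∁ A) * hits A     ≡⟨ cong (λ h → H.weight A * hits A + H∁.weight (∁ A) * h) (hits-∁ A) ⟨
    H.weight A * hits A + H∁.weight (∁ A) * hits (∁ A) ∎

-- The Lubell function

k!*[n∸k]! : ℕ → ℕ → ℕ
k!*[n∸k]! n i = i ! * (n ∸ i) !

nCk*k![n∸k]! : ∀ {n i} → i ≤ n → (n C i) * k!*[n∸k]! n i ≡ n !
nCk*k![n∸k]! {n} {i} i≤n = trans (cong (_* k!*[n∸k]! n i) (nCk≡n!/k![n-k]! i≤n))
                                   (m/n*n≡m ⦃ i !* (n ∸ i) !≢0 ⦄ (k![n∸k]!∣n! i≤n))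

-- Brings reciprocals to a common denominator, so that only numerators remain to be added; `mkℚᵘ`
-- stores the denominator minus one. The equation excludes the dummy case c = 0.
recip-≃ : ∀ c h d → c * h ≡ suc d → toℚᵘ (recip c) ℚᵘ.≃ mkℚᵘ (pos h) d
recip-≃ (suc c) h d eq = ℚᵘ.≃-trans (ℚ.toℚᵘ-fromℚᵘ (mkℚᵘ (pos 1) c)) (*≡* (begin
  pos 1 ℤ.* pos (suc d)  ≡⟨ ℤ.*-identityˡ (pos (suc d)) ⟩
  pos (suc d)            ≡⟨ cong pos eq ⟨
  pos (suc c * h)        ≡⟨ cong pos (*-comm (suc c) h) ⟩
  pos (h * suc c)        ≡⟨ ℤ.pos-* h (suc c) ⟩
  pos h ℤ.* pos (suc c)  ∎))
  where open ≡-Reasoning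

+-common-denominator : ∀ a b d → mkℚᵘ (pos a) d ℚᵘ.+ mkℚᵘ (pos b) d ℚᵘ.≃ mkℚᵘ (pos (a + b)) d
+-common-denominator a b d = *≡* (begin
  (pos a ℤ.* D ℤ.+ pos b ℤ.* D) ℤ.* D   ≡⟨ cong (ℤ._* D) (ℤ.*-distribʳ-+ D (pos a) (pos b)) ⟨
  (pos (a + b) ℤ.* D) ℤ.* D             ≡⟨ ℤ.*-assoc (pos (a + b)) D D ⟩
  pos (a + b) ℤ.* (D ℤ.* D)             ≡⟨ cong (pos (a + b) ℤ.*_) (ℤ.pos-* (suc d) (suc d)) ⟨
  pos (a + b) ℤ.* pos (suc d * suc d)   ∎)
  where
  open ≡-Reasoning
  D = pos (suc d)

-- Over the denominator n!, each member `A` contributes the numerator `hits A`.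
lubell-≃ : ∀ {d} → suc d ≡ n ! → (F : Family n) → toℚᵘ (lubell F) ℚᵘ.≃ mkℚᵘ (pos (∑ˡ F hits)) d
lubell-≃ d≡ []      = *≡* refl
lubell-≃ {n} {d} d≡ (A ∷ F) = ℚᵘ.≃-trans (ℚ.toℚᵘ-homo-+ (recip (n C ∣ A ∣)) (lubell F)) (ℚᵘ.≃-trans
  (ℚᵘ.+-cong (recip-≃ (n C ∣ A ∣) (hits A) d (trans (nCk*k![n∸k]! (∣p∣≤n A)) (sym d≡))) (lubell-≃ d≡ F))
  (+-common-denominator (hits A) (∑ˡ F hits) d))

lubell-bound : ∀ {k} (F : Family n) → ∑ˡ F hits ≤ n ! * k → lubell F ℚ.≤ pos k ℚ./ 1
lubell-bound {n} {k} F bound = ℚ.toℚᵘ-cancel-≤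
  (ℚᵘ.≤-respˡ-≃ (ℚᵘ.≃-sym (lubell-≃ d≡ F)) (ℚᵘ.≤-respʳ-≃ (ℚᵘ.≃-sym (ℚ.toℚᵘ-fromℚᵘ (mkℚᵘ (pos k) 0)))
    (*≤* (subst₂ ℤ._≤_ (sym (ℤ.*-identityʳ (pos (∑ˡ F hits)))) (ℤ.pos-* k (suc (pred (n !))))
      (ℤ.+≤+ (subst (∑ˡ F hits ≤_) (trans (*-comm (n !) k) (cong (k *_) (sym d≡))) bound))))))
  where
  d≡ : suc (pred (n !)) ≡ n !
  d≡ = suc-pred (n !) ⦃ n !≢0 ⦄

-- The largest binomial coefficients

∑ˡ-++ : (xs ys : List X) (f : X → ℕ) → ∑ˡ (xs ++ ys) f ≡ ∑ˡ xs f + ∑ˡ ys f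
∑ˡ-++ []       ys f = refl
∑ˡ-++ (x ∷ xs) ys f = trans (cong (f x +_) (∑ˡ-++ xs ys f)) (sym (+-assoc (f x) (∑ˡ xs f) (∑ˡ ys f)))

∑ˡ-∑ˡ : (xs : List X) (ys : List Y) (f : X → Y → ℕ) →
        ∑ˡ xs (λ x → ∑ˡ ys (f x)) ≡ ∑ˡ ys (λ y → ∑ˡ xs λ x → f x y)
∑ˡ-∑ˡ []       ys f = sym (∑ˡ-zero ys λ _ → refl)
∑ˡ-∑ˡ (x ∷ xs) ys f = trans (cong (∑ˡ ys (f x) +_) (∑ˡ-∑ˡ xs ys f))
                              (sym (∑ˡ-distrib-+ ys (f x) (λ y → ∑ˡ xs λ x → f x y)))

∑ˡ-sum : (xs : List X) (f : X → ℕ) → ∑ˡ xs f ≡ sumˡ (map f xs)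
∑ˡ-sum []       f = refl
∑ˡ-sum (x ∷ xs) f = cong (f x +_) (∑ˡ-sum xs f)

∑ˡ-↭ : {xs ys : List X} (f : X → ℕ) → xs ↭ ys → ∑ˡ xs f ≡ ∑ˡ ys f
∑ˡ-↭ {xs = xs} {ys} f xs↭ys = trans (∑ˡ-sum xs f) (trans (sum-↭ (↭-map⁺ f xs↭ys)) (sym (∑ˡ-sum ys f)))

∑ˡ-const : (xs : List X) (c : ℕ) → ∑ˡ xs (λ _ → c) ≡ length xs * c
∑ˡ-const []       c = refl
∑ˡ-const (x ∷ xs) c = cong (c +_) (∑ˡ-const xs c)

AllPairs-reverse : {R : X → X → Set} {xs : List X} → AllPairs R xs → AllPairs (λ x y → R y x) (reverse xs)
AllPairs-reverse [] = []
AllPairs-reverse {xs = x ∷ xs} (r ∷ rs) rewrite unfold-reverse x xs =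
  AllPairs.++⁺ (AllPairs-reverse rs) ([] ∷ [])
    (All.map (λ Rxy → Rxy ∷ []) (All-resp-↭ (↭-sym (↭-reverse xs)) r))

-- The pivot is the entry at index k, the first one not taken. It heads the dropped part itself,
-- which is where reflexivity enters.
threshold : {R : X → X → Set} → (∀ {x} → R x x) → ∀ k {xs : List X} → AllPairs R xs → k < length xs →
  ∃ λ t → t ∈ xs × All (λ x → R x t) (take k xs) × All (R t) (drop k xs)
threshold R-refl zero    {x ∷ xs} (r ∷ rs) _         = x , here refl , [] , R-refl ∷ r
threshold R-refl (suc k) {x ∷ xs} (r ∷ rs) (s≤s k<) =
  let t , t∈ , above , below = threshold R-refl k rs k< in t , there t∈ , All.lookup r t∈ ∷ above , below

-- The inequality (b ∸ f) (H ∸ h) ≥ 0, without subtraction.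
exchange : ∀ {f b h H} → f ≤ b → h ≤ H → f * H + b * h ≤ b * H + f * h
exchange {f} {b} {h} {H} f≤b h≤H with d , refl ← m≤n⇒∃[o]m+o≡n f≤b | e , refl ← m≤n⇒∃[o]m+o≡n h≤H =
  ≤-trans (m≤m+n (f * (h + e) + (f + d) * h) (d * e)) (≤-reflexive
    (solve 4 (λ f d h e → f :* (h :+ e) :+ (f :+ d) :* h :+ d :* e := (f :+ d) :* (h :+ e) :+ f :* h) refl f d h e))
  where open +-*-Solver

*-anti-≤ : ∀ {b h b′ h′ N} → .⦃ NonZero b ⦄ → b * h ≡ N → b′ * h′ ≡ N → b ≤ b′ → h′ ≤ h
*-anti-≤ {b} {h} {b′} {h′} eq eq′ b≤b′ = *-cancelˡ-≤ b
  (≤-trans (*-monoˡ-≤ h′ b≤b′) (≤-reflexive (trans eq′ (sym eq))))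

-- The greedy solution of the linear programme is optimal: h t, for the first t not taken, is the
-- dual price of the constraint.
fractional-knapsack : (b h f : X → ℕ) (N : ℕ) .⦃ _ : NonZero N ⦄ (k : ℕ) (xs : List X) →
  All (λ x → b x * h x ≡ N) xs → All (λ x → f x ≤ b x) xs →
  AllPairs (λ x y → b y ≤ b x) xs → k < length xs → ∑ˡ xs (λ x → f x * h x) ≤ N * k →
  ∑ˡ xs f ≤ ∑ˡ (take k xs) b
fractional-knapsack b h f N k xs bh≡N f≤b sorted k<len fh≤
  with t , t∈ , above , below ← threshold ≤-refl k sorted k<len
  -- Both sides are multiplied by the price `H` and increased by `N * k`, which is one copy of `N`
  -- for each entry taken; then the terms are compared one by one.
  = *-cancelʳ-≤ (∑ˡ xs f) (∑ˡ (take k xs) b) H (+-cancelʳ-≤ (N * k) (∑ˡ xs f * H) (∑ˡ top b * H) (begin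
  ∑ˡ xs f * H + N * k
    ≡⟨ cong₂ _+_ (trans (sym (∑ˡ-*ʳ xs f H)) (split λ x → f x * H)) (trans (*-comm N k) (sym top-N)) ⟩
  ∑ˡ top (λ x → f x * H) + ∑ˡ bot (λ x → f x * H) + ∑ˡ top (λ _ → N)
    ≡⟨ solve 3 (λ a b c → a :+ b :+ c := (a :+ c) :+ b) refl
         (∑ˡ top (λ x → f x * H)) (∑ˡ bot (λ x → f x * H)) (∑ˡ top (λ _ → N)) ⟩
  ∑ˡ top (λ x → f x * H) + ∑ˡ top (λ _ → N) + ∑ˡ bot (λ x → f x * H)
    ≡⟨ cong (_+ ∑ˡ bot (λ x → f x * H)) (∑ˡ-distrib-+ top (λ x → f x * H) (λ _ → N)) ⟨
  ∑ˡ top (λ x → f x * H + N) + ∑ˡ bot (λ x → f x * H)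
    ≤⟨ +-mono-≤ (∑ˡ-mono top top-term) (∑ˡ-mono bot bot-term) ⟩
  ∑ˡ top (λ x → b x * H + f x * h x) + ∑ˡ bot (λ x → f x * h x)
    ≡⟨ cong (_+ ∑ˡ bot (λ x → f x * h x)) (∑ˡ-distrib-+ top (λ x → b x * H) (λ x → f x * h x)) ⟩
  ∑ˡ top (λ x → b x * H) + ∑ˡ top (λ x → f x * h x) + ∑ˡ bot (λ x → f x * h x)
    ≡⟨ +-assoc (∑ˡ top (λ x → b x * H)) (∑ˡ top (λ x → f x * h x)) (∑ˡ bot (λ x → f x * h x)) ⟩
  ∑ˡ top (λ x → b x * H) + (∑ˡ top (λ x → f x * h x) + ∑ˡ bot (λ x → f x * h x))
    ≡⟨ cong₂ _+_ (∑ˡ-*ʳ top b H) (sym (split λ x → f x * h x)) ⟩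
  ∑ˡ top b * H + ∑ˡ xs (λ x → f x * h x)
    ≤⟨ +-monoʳ-≤ (∑ˡ top b * H) fh≤ ⟩
  ∑ˡ top b * H + N * k  ∎))
  where
  open ≤-Reasoning
  open +-*-Solver
  H = h t
  top = take k xs
  bot = drop k xs
  bH≡N : b t * H ≡ N
  bH≡N = All.lookup bh≡N t∈
  instance
    H≢0 : NonZero H
    H≢0 = m*n≢0⇒n≢0 (b t) ⦃ subst NonZero (sym bH≡N) it ⦄
    b≢0 : NonZero (b t)
    b≢0 = m*n≢0⇒m≢0 (b t) ⦃ subst NonZero (sym bH≡N) it ⦄
  split : ∀ g → ∑ˡ xs g ≡ ∑ˡ top g + ∑ˡ bot g
  split g = trans (cong (λ ys → ∑ˡ ys g) (sym (take++drop≡id k xs))) (∑ˡ-++ top bot g)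
  top-N : ∑ˡ top (λ _ → N) ≡ k * N
  top-N = trans (∑ˡ-const top N) (cong (_* N) (trans (length-take k xs) (m≤n⇒m⊓n≡m (<⇒≤ k<len))))
  top⊆ : ∀ {P : _ → Set} → All P xs → All P top
  top⊆ = All.take⁺ k
  bot⊆ : ∀ {P : _ → Set} → All P xs → All P bot
  bot⊆ = All.drop⁺ k
  -- A taken entry has b x at least b t, hence h x at most `H`; with `N` written as b x * h x this
  -- is `exchange`.
  top-term : ∀ {x} → x ∈ top → f x * H + N ≤ b x * H + f x * h x
  top-term {x} x∈ = ≤-trans (≤-reflexive (cong (λ z → f x * H + z) (sym (All.lookup (top⊆ bh≡N) x∈))))
    (exchange (All.lookup (top⊆ f≤b) x∈) (*-anti-≤ bH≡N (All.lookup (top⊆ bh≡N) x∈) (All.lookup above x∈)))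
  -- An entry not taken has b x at most b t, hence h x at least `H`.
  bot-term : ∀ {x} → x ∈ bot → f x * H ≤ f x * h x
  bot-term {x} x∈ = *-monoʳ-≤ (f x) (*-anti-≤ ⦃ bx≢0 ⦄ (All.lookup (bot⊆ bh≡N) x∈) bH≡N (All.lookup below x∈))
    where bx≢0 = m*n≢0⇒m≢0 (b x) ⦃ subst NonZero (sym (All.lookup (bot⊆ bh≡N) x∈)) it ⦄

-- Level sizes and the cardinality bound

module _ (F : Family n) (F! : Unique F) where

  level : ℕ → ℕ
  level i = ∑ˡ F λ A → 𝟙 (∣ A ∣ ≟ i)

  level-weight : ∀ i → ∑ˡ F (λ A → 𝟙 (∣ A ∣ ≟ i) * hits A) ≡ level i * k!*[n∸k]! n i
  level-weight i = trans (∑ˡ-cong F same) (∑ˡ-*ʳ F (λ A → 𝟙 (∣ A ∣ ≟ i)) (k!*[n∸k]! n i))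
    where
    same : ∀ A → 𝟙 (∣ A ∣ ≟ i) * hits A ≡ 𝟙 (∣ A ∣ ≟ i) * k!*[n∸k]! n i
    same A with ∣ A ∣ ≟ i
    ... | yes eq = cong (λ j → 1 * k!*[n∸k]! n j) eq
    ... | no _   = refl

  -- Double counting: a full chain contains at most one set of size `i`, and each such set lies on
  -- i! (n - i)! of the n! chains.
  level-bound : ∀ {i} → i ≤ n → level i ≤ n C i
  level-bound {i} i≤n = *-cancelʳ-≤ (level i) (n C i) (k!*[n∸k]! n i) ⦃ i !* (n ∸ i) !≢0 ⦄ (begin
    level i * k!*[n∸k]! n i
      ≡⟨ level-weight i ⟨
    ∑ˡ F (λ A → 𝟙 (∣ A ∣ ≟ i) * hits A)
      ≡⟨ ∑ˡ-cong F (∑ᶜ-hit-× (λ A → ∣ A ∣ ≟ i)) ⟨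
    ∑ˡ F (λ A → ∑ᶜ λ v → 𝟙 (hit? v A ×-dec (∣ A ∣ ≟ i)))
      ≡⟨ ∑ᶜ-∑ˡ F (λ v A → 𝟙 (hit? v A ×-dec (∣ A ∣ ≟ i))) ⟨
    ∑ᶜ (λ v → ∑ˡ F λ A → 𝟙 (hit? v A ×-dec (∣ A ∣ ≟ i)))
      ≤⟨ ∑ᶜ-mono (λ v _ → ∑ˡ-𝟙≤1 (λ A → hit? v A ×-dec (∣ A ∣ ≟ i)) F! λ _ _ (hA , A≡) (hB , B≡) →
           ⊆-antisym (hit-mono v hA hB (≤-reflexive (trans A≡ (sym B≡))))
                     (hit-mono v hB hA (≤-reflexive (trans B≡ (sym A≡))))) ⟩
    ∑ᶜ {n} (λ _ → 1)
      ≡⟨ trans (∑ᶜ-const n 1) (*-identityʳ (n !)) ⟩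
    n !
      ≡⟨ nCk*k![n∸k]! i≤n ⟨
    (n C i) * k!*[n∸k]! n i  ∎)
    where open ≤-Reasoning

  length≤levels : length F ≤ ∑ˡ (upTo (suc n)) level
  length≤levels = begin
    length F
      ≡⟨ trans (∑ˡ-const F 1) (*-identityʳ (length F)) ⟨
    ∑ˡ F (λ _ → 1)
      ≤⟨ ∑ˡ-mono F (λ {A} _ → ≤-trans (≤-reflexive (sym (𝟙-true (∣ A ∣ ≟ ∣ A ∣) refl)))
           (∑ˡ-term (λ i → 𝟙 (∣ A ∣ ≟ i)) (∈-upTo⁺ (s≤s (∣p∣≤n A))))) ⟩
    ∑ˡ F (λ A → ∑ˡ (upTo (suc n)) λ i → 𝟙 (∣ A ∣ ≟ i))
      ≡⟨ ∑ˡ-∑ˡ F (upTo (suc n)) (λ A i → 𝟙 (∣ A ∣ ≟ i)) ⟩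
    ∑ˡ (upTo (suc n)) level  ∎
    where open ≤-Reasoning

  levels≤hits : ∑ˡ (upTo (suc n)) (λ i → level i * k!*[n∸k]! n i) ≤ ∑ˡ F hits
  levels≤hits = begin
    ∑ˡ (upTo (suc n)) (λ i → level i * k!*[n∸k]! n i)
      ≡⟨ ∑ˡ-cong (upTo (suc n)) level-weight ⟨
    ∑ˡ (upTo (suc n)) (λ i → ∑ˡ F λ A → 𝟙 (∣ A ∣ ≟ i) * hits A)
      ≡⟨ ∑ˡ-∑ˡ F (upTo (suc n)) (λ A i → 𝟙 (∣ A ∣ ≟ i) * hits A) ⟨
    ∑ˡ F (λ A → ∑ˡ (upTo (suc n)) λ i → 𝟙 (∣ A ∣ ≟ i) * hits A)
      ≤⟨ ∑ˡ-mono F (λ {A} _ → ≤-trans (≤-reflexive (∑ˡ-*ʳ (upTo (suc n)) (λ i → 𝟙 (∣ A ∣ ≟ i)) (hits A)))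
           (≤-trans (*-monoˡ-≤ (hits A) (∑ˡ-𝟙≤1 (∣ A ∣ ≟_) (Unique.upTo⁺ (suc n)) λ _ _ A≡i A≡j → trans (sym A≡i) A≡j))
                    (≤-reflexive (*-identityˡ (hits A))))) ⟩
    ∑ˡ F hits  ∎
    where open ≤-Reasoning

  -- A knapsack over the levels: level `i` has capacity `n C i` and cost i! (n - i)! per set, with
  -- product n!, and the budget is n! k. There are n + 1 levels, so k ≤ n leaves one that is not
  -- taken, as the price argument requires.
  length-bound : ∀ {k} → k ≤ n → ∑ˡ F hits ≤ n ! * k → length F ≤ Σnk n k
  length-bound {k} k≤n bound
    -- `Σnk` sorts the values, whereas level sizes depend on the index; so the sorted list is
    -- written as the image of a permutation `ls` of the levels.
    with ls , ys≡ , levels↭ls ← ↭-map-inv (n C_) (↭-sym (↭-trans (↭-reverse _) (sort-↭ (map (n C_) (upTo (suc n))))))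
    = begin
    length F
      ≤⟨ length≤levels ⟩
    ∑ˡ (upTo (suc n)) level
      ≡⟨ ∑ˡ-↭ level levels↭ls ⟩
    ∑ˡ ls level
      ≤⟨ fractional-knapsack (n C_) (k!*[n∸k]! n) level (n !) ⦃ n !≢0 ⦄ k ls
           (All.map nCk*k![n∸k]! ls≤n) (All.map level-bound ls≤n) ls-sorted k<ls
           (≤-trans (≤-reflexive (sym (∑ˡ-↭ (λ i → level i * k!*[n∸k]! n i) levels↭ls))) (≤-trans levels≤hits bound)) ⟩
    ∑ˡ (take k ls) (n C_)
      ≡⟨ ∑ˡ-sum (take k ls) (n C_) ⟩
    sumˡ (map (n C_) (take k ls))
      ≡⟨ cong sumˡ (take-map k ls) ⟨
    sumˡ (take k (map (n C_) ls))
      ≡⟨ cong (sumˡ ∘ take k) ys≡ ⟨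
    Σnk n k  ∎
    where
    open ≤-Reasoning
    ls≤n : All (_≤ n) ls
    ls≤n = All-resp-↭ levels↭ls (All.tabulate (s≤s⁻¹ ∘ ∈-upTo⁻))
    ls-sorted : AllPairs (λ i j → n C j ≤ n C i) ls
    ls-sorted = AllPairs.map⁻ (subst (AllPairs _≥_) ys≡
      (AllPairs-reverse (Linked⇒AllPairs ≤-trans (sort-↗ (map (n C_) (upTo (suc n)))))))
    k<ls : k < length ls
    k<ls = subst (k <_) (trans (sym (length-upTo (suc n))) (↭-length levels↭ls)) (s≤s k≤n)

open import Data.Integer using (+_)

theorem1p3 : (k n : ℕ) → 2 ≤ k → suc k ≤ n → (F : Family n) → Unique F →
    ¬ InducedIn (Yel k) _<Y_ F → ¬ InducedIn (Yel k) _<Y'_ F →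
    ⊥ ∉ F → ⊤ ∉ F →
    (lubell F ≤ℚ (+ k) / 1) × (length F ≤ Σnk n k)
theorem1p3 (suc (suc m)) n (s≤s (s≤s _)) k<n F F! ¬Y ¬Y' ⊥∉F ⊤∉F =
  lubell-bound F bound , length-bound F F! (<⇒≤ k<n) bound
  where bound = weighted-bound F F! ¬Y ¬Y' ⊥∉F ⊤∉F
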